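{- Let $H$ be one of the following graphs: the triangle, the paw, the claw, the diamond. Then every $(2K_2, H)$-free graph is recolorable.
   Context: All graphs are finite and simple. A $k$-coloring of $G$ is a map $V(G)\to\{1,\dots,k\}$ giving adjacent vertices different values; $\chi(G)$ is the chromatic number. $R_k(G)$ denotes the graph whose vertices are the $k$-colorings of $G$, two being adjacent if they differ in color on exactly one vertex. $G$ is recolorable if $R_\ell(G)$ is connected for all $\ell\ge\chi(G)+1$. A graph is $(H_1,\dots,H_r)$-free if it has no induced subgraph isomorphic to any $H_i$. $2K_2$ is the disjoint union of two edges; the triangle is $K_3$; the paw is a triangle together with one extra vertex adjacent to exactly one vertex of the triangle; the claw is $K_{1,3}$; the diamond is $K_4$ minus an edge. -}

module Defs where

open import Data.Fin using (Fin; #_; _≟_)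
open import Data.Fin.Properties using (all?; any?)
open import Data.List using (List; []; _∷_)
open import Data.List.Relation.Unary.All using (All)
import Data.List.Membership.DecPropositional as DecMembership
open import Data.Nat using (ℕ; zero; suc; _+_; _≤_; _≥_; z≤n; s≤s)
open import Data.Product using (∃; ∃-syntax; ∃!; _×_; _,_; proj₁; proj₂)
open import Data.Product.Properties using (≡-dec)
open import Data.Sum using (_⊎_; swap)
open import Data.Vec using (Vec; []; _∷_; lookup; allFin)
open import Data.Vec.Properties using (lookup-allFin)
open import Function using (_∘_)
open import Function.Bundles using (_⇔_)
open import Function.Definitions using (Injective)
open import Level using (0ℓ)
open import Relation.Binary.Core using (Rel)
open import Relation.Binary.Definitions using (Symmetric; Irreflexive; Decidable)
open import Relation.Binary.Construct.Closure.ReflexiveTransitive using (Star)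
open import Relation.Binary.PropositionalEquality
  using (_≡_; _≢_; sym; trans)
open import Relation.Nullary using (¬_; Dec; yes; no; contradiction)
open import Relation.Nullary.Decidable
  using (map′; ¬?; _×-dec_; _⊎-dec_; _→-dec_; recompute)
import Relation.Unary as U

record Graph : Set₁ where
  field
    order  : ℕ
    _~_    : Rel (Fin order) 0ℓ
    _~?_   : Decidable _~_
    ~-sym  : Symmetric _~_
    ~-irr  : Irreflexive _≡_ _~_

  Vertex : Set
  Vertex = Fin order

open Graph public using (order; Vertex)

-- Each edge is listed once, in either orientation.
fromEdges : ∀ n → List (Fin n × Fin n) → Graph
fromEdges n es = record
  { order = n
  ; _~_   = λ u v → u ≢ v × ((u , v) ∈ es ⊎ (v , u) ∈ es)
  ; _~?_  = λ u v → ¬? (u ≟ v) ×-dec (((u , v) ∈? es) ⊎-dec ((v , u) ∈? es))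
  ; ~-sym = λ (u≢v , e) → u≢v ∘ sym , swap e
  ; ~-irr = λ u≡v (u≢v , _) → u≢v u≡v
  }
  where open DecMembership (≡-dec (_≟_ {n}) (_≟_ {n})) using (_∈_; _∈?_)

2K₂ triangle paw claw diamond : Graph
2K₂      = fromEdges 4 ((# 0 , # 1) ∷ (# 2 , # 3) ∷ [])
triangle = fromEdges 3 ((# 0 , # 1) ∷ (# 0 , # 2) ∷ (# 1 , # 2) ∷ [])
paw      = fromEdges 4 ((# 0 , # 1) ∷ (# 0 , # 2) ∷ (# 1 , # 2) ∷ (# 0 , # 3) ∷ [])
claw     = fromEdges 4 ((# 0 , # 1) ∷ (# 0 , # 2) ∷ (# 0 , # 3) ∷ [])
diamond  = fromEdges 4 ((# 0 , # 1) ∷ (# 0 , # 2) ∷ (# 0 , # 3) ∷ (# 1 , # 2) ∷ (# 1 , # 3) ∷ [])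

-- f is an isomorphism from H onto the subgraph of G induced by the image of f.
record InducedCopy (H G : Graph) : Set where
  open Graph H using () renaming (_~_ to _~ᴴ_)
  open Graph G using () renaming (_~_ to _~ᴳ_)
  field
    f         : Vertex H → Vertex G
    injective : Injective _≡_ _≡_ f
    adjacent  : ∀ u v → u ~ᴴ v ⇔ f u ~ᴳ f v

_-Free : List Graph → Graph → Set₁
(Hs -Free) G = All (λ H → ¬ InducedCopy H G) Hs

IsColoring : ∀ G {k} → Vec (Fin k) (order G) → Set
IsColoring G c = ∀ u v → u ~ v → lookup c u ≢ lookup c v
  where open Graph G

-- The vector representation and the irrelevant properness proof ensure that
-- colorings agreeing on every vertex are propositionally equal.
record Coloring (G : Graph) (k : ℕ) : Set where
  constructor coloring
  field
    colors  : Vec (Fin k) (order G)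
    .proper : IsColoring G colors

open Coloring public using (colors)

_at_ : ∀ {G k} → Coloring G k → Vertex G → Fin k
c at v = lookup (colors c) v

isColoring? : ∀ G {k} → U.Decidable (IsColoring G {k})
isColoring? G c =
  all? λ u → all? λ v → (u ~? v) →-dec ¬? (lookup c u ≟ lookup c v)
  where open Graph G

isColoring : ∀ {G k} (c : Coloring G k) → IsColoring G (colors c)
isColoring {G} (coloring c p) = recompute (isColoring? G c) p

IsChromaticNumber : Graph → ℕ → Set
IsChromaticNumber G k = Coloring G k × (∀ {j} → Coloring G j → k ≤ j)

private
  anyVec? : ∀ {k} n {P : U.Pred (Vec (Fin k) n) 0ℓ} → U.Decidable P → Dec (∃ P)
  anyVec? zero    P? = map′ ([] ,_) (λ { ([] , p) → p }) (P? [])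
  anyVec? (suc n) P? =
    map′ (λ (x , xs , p) → x ∷ xs , p) (λ { (x ∷ xs , p) → x , xs , p })
         (any? λ x → anyVec? n (P? ∘ (x ∷_)))

  least : ∀ {P : U.Pred ℕ 0ℓ} → U.Decidable P → ∀ n → P n →
          ∃[ k ] P k × (∀ {j} → P j → k ≤ j)
  least P? n pn with P? 0
  least P? n       pn | yes p₀ = 0 , p₀ , λ _ → z≤n
  least P? zero    p₀ | no ¬p₀ = contradiction p₀ ¬p₀
  least P? (suc n) pn | no ¬p₀ with least (P? ∘ suc) n pn
  ... | k , pk , k-min = suc k , pk , λ
    { {zero}  p₀ → contradiction p₀ ¬p₀
    ; {suc j} pj → s≤s (k-min pj)
    }

coloring? : ∀ G → U.Decidable (Coloring G)
coloring? G k =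
  map′ (λ (c , p) → coloring c p)
       (λ c → colors c , isColoring c)
       (anyVec? (order G) (isColoring? G))

rainbow : ∀ G → Coloring G (order G)
rainbow G = coloring (allFin (order G)) distinct
  where
  open Graph G using (~-irr)
  distinct : IsColoring G (allFin (order G))
  distinct u v u~v eq =
    ~-irr (trans (sym (lookup-allFin u)) (trans eq (lookup-allFin v))) u~v

chromaticNumber : ∀ G → ∃ (IsChromaticNumber G)
chromaticNumber G = least (coloring? G) (order G) (rainbow G)

χ : Graph → ℕ
χ = proj₁ ∘ chromaticNumber

χ-isChromaticNumber : ∀ G → IsChromaticNumber G (χ G)
χ-isChromaticNumber = proj₂ ∘ chromaticNumber

-- The adjacency relation of R_k(G).
R : ∀ G k → Rel (Coloring G k) 0ℓ
R G k c d = ∃! _≡_ λ v → c at v ≢ d at v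

Connected : {A : Set} → Rel A 0ℓ → Set
Connected _~_ = ∀ x y → Star _~_ x y

Recolorable : Graph → Set
Recolorable G = ∀ ℓ → ℓ ≥ χ G + 1 → Connected (R G ℓ)

{-# OPTIONS --safe #-}
module Submission where

-- Let L be the palette and suppose the graph has a coloring α that misses some color of L.
-- Three reductions delete vertices:
-- a vertex u with N(u) ⊆ N(v) can imitate v; a vertex of degree at most |L| ∸ 2 can step aside;
-- and if every coloring has a (possibly empty) color class B inside a class A of some coloring
-- that misses a color, then A can take over the color of B and be removed together with it.
-- For a 2K₂-free graph without comparable neighborhoods:
-- if it is paw-free and has a triangle, it is complete; if it is triangle-free and not complete,
-- it is C₅; if it is claw-free, either no three vertices are independent, and some color class
-- has at most one vertex, or a vertex of any independent triple has small degree; if it is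
-- diamond-free with a triangle but not complete, each other vertex is adjacent to exactly one
-- corner, and at most two vertices are attached to each corner, which forces a class B as above.

open import Defs
open import Data.Bool using (if_then_else_)
open import Data.Empty using (⊥)
open import Data.Fin as Fin using (Fin; _≟_; inject≤; fromℕ<; toℕ)
open import Data.Fin.Permutation.Components using (transpose; transpose-inverse)
import Data.Fin.Properties as Fin
open import Data.List as List using (List; []; _∷_; _++_; length; map; filter; allFin)
import Data.List.Membership.DecPropositional as DecMembership
open import Data.List.Membership.Propositional using (_∈_; _∉_; find; lose)
open import Data.List.Membership.Propositional.Properties
  using (∈-filter⁺; ∈-filter⁻; ∈-map⁺; ∈-++⁻; ∈-allFin)
open import Data.List.Properties using (length-map; length-++; filter-notAll)
open import Data.List.Relation.Binary.Subset.Propositional using (_⊆_)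
open import Data.List.Relation.Unary.All as All using ([]; _∷_)
import Data.List.Relation.Unary.All.Properties as All
open import Data.List.Relation.Unary.AllPairs using (AllPairs; []; _∷_)
open import Data.List.Relation.Unary.Any as Any using (here; there)
open import Data.List.Relation.Unary.Unique.Propositional using (Unique)
import Data.List.Relation.Unary.Unique.Propositional.Properties as Unique
open import Data.Nat using (ℕ; suc; _+_; _*_; _≤_; _<_; z≤n; s≤s; _≤?_)
open import Data.Nat.Properties
  using (≤-refl; ≤-trans; <-≤-trans; ≤-<-trans; +-mono-≤; +-mono-<; +-monoʳ-≤; *-monoˡ-<;
         *-identityʳ; *-comm; +-comm; +-suc; +-identityʳ; ≰⇒>; <⇒≱; <⇒≤; <⇒≢; +-cancelˡ-<)
open import Data.Product using (∃-syntax; _×_; _,_; proj₁; proj₂)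
open import Data.Sum using (_⊎_; inj₁; inj₂)
open import Data.Unit using (⊤; tt)
open import Data.Vec using ([]; _∷_; lookup; tabulate)
open import Data.Vec.Properties using (lookup∘tabulate; tabulate∘lookup; tabulate-cong)
open import Function using (_∘_; id)
open import Function.Bundles using (_⇔_; mk⇔; Equivalence)
open import Function.Definitions using (Injective)
open import Level using (0ℓ)
open import Relation.Binary.Construct.Closure.ReflexiveTransitive using (Star; ε; _◅_; _◅◅_)
open import Relation.Binary.Core using (Rel)
open import Relation.Binary.Definitions using (DecidableEquality; tri<; tri≈; tri>)
open import Relation.Binary.PropositionalEquality
  using (_≡_; _≢_; refl; sym; trans; cong; subst; ≢-sym)
open import Relation.Nullary using (¬_; Dec; yes; no; does; contradiction)
open import Relation.Nullary.Decidable
  using (¬?; _×-dec_; _⊎-dec_; _→-dec_; decidable-stable; dec-true)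
open import Relation.Unary using (Pred; Decidable)

-- Finite lists

module _ {A : Set} {P : Pred A 0ℓ} (P? : Decidable P) where

  search : ∀ xs → (∃[ x ] x ∈ xs × P x) ⊎ (∀ {x} → x ∈ xs → ¬ P x)
  search xs with Any.any? P? xs
  ... | yes p = inj₁ (find p)
  ... | no ¬p = inj₂ λ x∈ px → ¬p (lose x∈ px)

  length-filter-split : ∀ xs → length xs ≡ length (filter P? xs) + length (filter (¬? ∘ P?) xs)
  length-filter-split [] = refl
  length-filter-split (x ∷ xs) with P? x
  ... | yes _ = cong suc (length-filter-split xs)
  ... | no  _ = trans (cong suc (length-filter-split xs)) (sym (+-suc _ _))

infixl 6 _∖_
_∖_ : {A : Set} {P : Pred A 0ℓ} → List A → Decidable P → List A
xs ∖ P? = filter (¬? ∘ P?) xs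

module _ {A : Set} {P : Pred A 0ℓ} (P? : Decidable P) where

  ∈-∖⁺ : ∀ {x xs} → x ∈ xs → ¬ P x → x ∈ xs ∖ P?
  ∈-∖⁺ = ∈-filter⁺ (¬? ∘ P?)

  ∈-∖⁻ : ∀ {x} xs → x ∈ xs ∖ P? → x ∈ xs × ¬ P x
  ∈-∖⁻ xs = ∈-filter⁻ (¬? ∘ P?) {xs = xs}

  ∖-length-< : ∀ {x xs} → x ∈ xs → P x → length (xs ∖ P?) < length xs
  ∖-length-< {xs = xs} x∈ px = filter-notAll (¬? ∘ P?) xs (lose x∈ (λ ¬px → ¬px px))

module _ {A : Set} where

  ∈-length1 : ∀ {x y : A} {xs} → length xs ≤ 1 → x ∈ xs → y ∈ xs → x ≡ y
  ∈-length1 _ (here refl) (here refl) = refl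
  ∈-length1 {xs = _ ∷ _ ∷ _} (s≤s ()) _ _

  length≤1 : ∀ {xs : List A} → Unique xs → (∀ {x y} → x ∈ xs → y ∈ xs → x ≡ y) → length xs ≤ 1
  length≤1 {[]} _ _ = z≤n
  length≤1 {_ ∷ []} _ _ = ≤-refl
  length≤1 {_ ∷ _ ∷ _} ((x≢y ∷ _) ∷ _) eq = contradiction (eq (here refl) (there (here refl))) x≢y

  length≤2 : ∀ {xs : List A} → Unique xs →
             (∀ {x y z} → x ∈ xs → y ∈ xs → z ∈ xs → x ≢ y → x ≢ z → ¬ y ≢ z) → length xs ≤ 2
  length≤2 {[]} _ _ = z≤n
  length≤2 {_ ∷ []} _ _ = s≤s z≤n
  length≤2 {_ ∷ _ ∷ []} _ _ = ≤-refl
  length≤2 {_ ∷ _ ∷ _ ∷ _} ((x≢y ∷ x≢z ∷ _) ∷ (y≢z ∷ _) ∷ _) no3 =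
    contradiction y≢z (no3 (here refl) (there (here refl)) (there (there (here refl))) x≢y x≢z)

module _ {A B : Set} (_≟B_ : DecidableEquality B) (f : A → B) where

  -- Pigeonhole: the fibre over the head of `ys` is split off, and what remains of `xs` maps into
  -- the tail.
  length-≤-by-fibres : ∀ {m} (ys : List B) {xs : List A} → Unique xs →
    (∀ {x} → x ∈ xs → f x ∈ ys) →
    (∀ {b zs} → Unique zs → zs ⊆ xs → (∀ {z} → z ∈ zs → f z ≡ b) → length zs ≤ m) →
    length xs ≤ length ys * m
  length-≤-by-fibres [] {[]} _ _ _ = z≤n
  length-≤-by-fibres [] {_ ∷ _} _ f∈ _ with () ← f∈ (here refl)
  length-≤-by-fibres {m} (b ∷ ys) {xs} uniq f∈ fibre =
    subst (_≤ _) (sym (length-filter-split b? xs)) (+-mono-≤ fibre-b rest)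
    where
    b? : Decidable (λ x → f x ≡ b)
    b? x = f x ≟B b
    fibre-b : length (filter b? xs) ≤ m
    fibre-b = fibre (Unique.filter⁺ b? uniq) (proj₁ ∘ ∈-filter⁻ b? {xs = xs})
                    (proj₂ ∘ ∈-filter⁻ b? {xs = xs})
    into : ∀ {x} → x ∈ xs ∖ b? → f x ∈ ys
    into x∈ with x∈xs , fx≢b ← ∈-∖⁻ b? xs x∈ with f∈ x∈xs
    ... | here fx≡b = contradiction fx≡b fx≢b
    ... | there fx∈ = fx∈
    rest : length (xs ∖ b?) ≤ length ys * m
    rest = length-≤-by-fibres ys (Unique.filter⁺ (¬? ∘ b?) uniq) into
             λ u zs⊆ → fibre u (proj₁ ∘ ∈-∖⁻ b? xs ∘ zs⊆)

  -- A fibre with two or more elements costs two elements of `xs`, so dropping it together with `b`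
  -- keeps the inequality strict; uniqueness leaves the other fibres untouched.
  small-fibre : ∀ {ys : List B} {xs : List A} → Unique ys → length xs < length ys * 2 →
    ∃[ b ] b ∈ ys × (∀ {x y} → x ∈ xs → y ∈ xs → f x ≡ b → f y ≡ b → x ≡ y)
  small-fibre {b ∷ ys} {xs} (b∉ys ∷ uniq) short = split (length (filter b? xs) ≤? 1)
    where
    b? : Decidable (λ x → f x ≡ b)
    b? x = f x ≟B b
    split : Dec (length (filter b? xs) ≤ 1) →
      ∃[ c ] c ∈ b ∷ ys × (∀ {x y} → x ∈ xs → y ∈ xs → f x ≡ c → f y ≡ c → x ≡ y)
    split (yes ≤1) = b , here refl , λ x∈ y∈ fx fy →
      ∈-length1 ≤1 (∈-filter⁺ b? x∈ fx) (∈-filter⁺ b? y∈ fy)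
    split (no ≰1) = let c , c∈ys , thin = small-fibre uniq short′ in
      c , there c∈ys , λ x∈ y∈ fx fy →
        thin (∈-∖⁺ b? x∈ (λ e → All.lookup b∉ys c∈ys (trans (sym e) fx)))
             (∈-∖⁺ b? y∈ (λ e → All.lookup b∉ys c∈ys (trans (sym e) fy))) fx fy
      where
      short′ : length (xs ∖ b?) < length ys * 2
      short′ = +-cancelˡ-< 2 _ _ (≤-<-trans (+-mono-≤ (≰⇒> ≰1) ≤-refl)
                 (subst (_< _) (length-filter-split b? xs) short))

module _ {A : Set} (_≟A_ : DecidableEquality A) where
  open DecMembership _≟A_ using (_∈?_)

  ⊆-length : ∀ {xs ys : List A} → Unique xs → xs ⊆ ys → length xs ≤ length ys
  ⊆-length {ys = ys} uniq xs⊆ys = subst (_ ≤_) (*-identityʳ _)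
    (length-≤-by-fibres _≟A_ id ys uniq xs⊆ys
      λ u _ eq → length≤1 u λ x∈ y∈ → trans (eq x∈) (sym (eq y∈)))

  fresh : ∀ {xs ys : List A} → Unique ys → length xs < length ys → ∃[ y ] y ∈ ys × y ∉ xs
  fresh {xs} {ys} uniq short with search (λ y → ¬? (y ∈? xs)) ys
  ... | inj₁ found = found
  ... | inj₂ none  = contradiction
          (⊆-length uniq (λ y∈ → decidable-stable (_ ∈? xs) (none y∈))) (<⇒≱ short)

-- Transpositions and repainting

module _ {n} {a b : Fin n} where

  transpose-matches : transpose a b a ≡ b
  transpose-matches rewrite dec-true (a ≟ a) refl = refl

  transpose-injective : Injective _≡_ _≡_ (transpose a b)
  transpose-injective eq =
    trans (sym (transpose-inverse b a)) (trans (cong (transpose b a) eq) (transpose-inverse b a))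

  transpose-∈ : ∀ {c L} → a ∈ L → b ∈ L → c ∈ L → transpose a b c ∈ L
  transpose-∈ {c} a∈ b∈ c∈ with c ≟ a
  ... | yes _ = b∈
  ... | no  _ with c ≟ b
  ...   | yes _ = a∈
  ...   | no  _ = c∈

module _ {V C : Set} {P : Pred V 0ℓ} (P? : Decidable P) where

  paint : C → (V → C) → V → C
  paint b f v = if does (P? v) then b else f v

  paint-in : ∀ {b} f {v} → P v → paint b f v ≡ b
  paint-in _ {v} p with P? v
  ... | yes _ = refl
  ... | no ¬p = contradiction p ¬p

  paint-out : ∀ {b} f {v} → ¬ P v → paint b f v ≡ f v
  paint-out _ {v} ¬p with P? v
  ... | yes p = contradiction p ¬p
  ... | no _  = refl

-- Recoloring a set of vertices from a palette

module Recoloring (G : Graph) (ℓ : ℕ) where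
  open Graph G using (_~_; _~?_; ~-sym; ~-irr)

  V C : Set
  V = Vertex G
  C = Fin ℓ

  -- Colorings are total functions whose values count on `S` only, so deleting vertices or colors
  -- changes `S` and `L` but never the function.
  record Proper (S : List V) (L : List C) (f : V → C) : Set where
    field
      inPalette : ∀ {v} → v ∈ S → f v ∈ L
      separates : ∀ {u v} → u ∈ S → v ∈ S → u ~ v → f u ≢ f v
  open Proper public

  -- No change at all is allowed too, so that pointwise equal colorings are one move apart.
  OneChange : List V → (V → C) → (V → C) → Set
  OneChange S f g = ∀ {u v} → u ∈ S → v ∈ S → f u ≢ g u → f v ≢ g v → u ≡ v

  Move : List V → List C → (V → C) → (V → C) → Set
  Move S L f g = Proper S L g × OneChange S f g

  Reach : List V → List C → (V → C) → (V → C) → Set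
  Reach S L = Star (Move S L)

  Conn : List V → List C → Set
  Conn S L = ∀ {f g} → Proper S L f → Proper S L g → Reach S L f g

  _≈[_]_ : (V → C) → List V → (V → C) → Set
  f ≈[ S ] g = ∀ {v} → v ∈ S → f v ≡ g v

  ≈-move : ∀ {S L f g} → Proper S L g → f ≈[ S ] g → Reach S L f g
  ≈-move pg eq = (pg , λ u∈ _ u≢ _ → contradiction (eq u∈) u≢) ◅ ε

  restrict : ∀ {S L f} {P : Pred V 0ℓ} (P? : Decidable P) → Proper S L f → Proper (S ∖ P?) L f
  restrict {S} P? pf = record
    { inPalette = inPalette pf ∘ ⊆S
    ; separates = λ u∈ v∈ → separates pf (⊆S u∈) (⊆S v∈)
    }
    where
    ⊆S : ∀ {v} → v ∈ S ∖ P? → v ∈ S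
    ⊆S = proj₁ ∘ ∈-∖⁻ P? S

  Independent : List V → Pred V 0ℓ → Set
  Independent S P = ∀ {u v} → u ∈ S → v ∈ S → P u → P v → ¬ u ~ v

  -- Repainting an independent set with one color

  module _ {S : List V} {L : List C} {P : Pred V 0ℓ} (P? : Decidable P) {b : C} where

    paint-proper : ∀ {f} → b ∈ L → Independent S P → Proper (S ∖ P?) L f →
      (∀ {u v} → u ∈ S → v ∈ S → P u → ¬ P v → u ~ v → f v ≢ b) → Proper S L (paint P? b f)
    paint-proper {f} b∈ indep pf apart = record { inPalette = inL ; separates = sep }
      where
      inL : ∀ {v} → v ∈ S → paint P? b f v ∈ L
      inL {v} v∈ with P? v
      ... | yes _ = b∈
      ... | no ¬p = inPalette pf (∈-∖⁺ P? v∈ ¬p)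
      sep : ∀ {u v} → u ∈ S → v ∈ S → u ~ v → paint P? b f u ≢ paint P? b f v
      sep {u} {v} u∈ v∈ u~v with P? u | P? v
      ... | yes p | yes q = λ _ → indep u∈ v∈ p q u~v
      ... | yes p | no ¬q = λ eq → apart u∈ v∈ p ¬q u~v (sym eq)
      ... | no ¬p | yes q = λ eq → apart v∈ u∈ q ¬p (~-sym u~v) eq
      ... | no ¬p | no ¬q = separates pf (∈-∖⁺ P? u∈ ¬p) (∈-∖⁺ P? v∈ ¬q) u~v

  module _ {S : List V} {L : List C} {P : Pred V 0ℓ} (P? : Decidable P) {b : C} where
    open DecMembership (_≟_ {order G}) using (_∈?_)

    -- The vertices of P can be painted one at a time.
    paint-reach : ∀ {f} → b ∈ L → Independent S P → Proper S L f →
      (∀ {v} → v ∈ S → f v ≡ b → P v) → Reach S L f (paint P? b f)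
    paint-reach {f} b∈ indep pf class⊆P =
      partial S ◅◅ ≈-move (subpaint-proper P? id) agree
      where
      -- Any part `Q` of `P` may be painted: vertices that already have color `b` lie in the
      -- independent set `P`, so none is adjacent to `Q`.
      subpaint-proper : ∀ {Q : Pred V 0ℓ} (Q? : Decidable Q) → (∀ {v} → Q v → P v) →
                        Proper S L (paint Q? b f)
      subpaint-proper Q? Q⊆P = paint-proper Q? b∈ (λ u∈ v∈ p q → indep u∈ v∈ (Q⊆P p) (Q⊆P q))
        (restrict Q? pf) (λ u∈ v∈ q _ u~v eq → indep u∈ v∈ (Q⊆P q) (class⊆P v∈ eq) u~v)
      _∩P? : ∀ xs → Decidable (λ v → P v × v ∈ xs)
      (xs ∩P?) v = P? v ×-dec (v ∈? xs)
      one : ∀ x xs → OneChange S (paint (xs ∩P?) b f) (paint ((x ∷ xs) ∩P?) b f)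
      one x xs {u} {v} _ _ u≢ v≢ = trans (only u≢) (sym (only v≢))
        where
        only : ∀ {w} → paint (xs ∩P?) b f w ≢ paint ((x ∷ xs) ∩P?) b f w → w ≡ x
        only {w} w≢ = decidable-stable (w ≟ x) λ w≢x → w≢ (same w≢x)
          where
          same : w ≢ x → paint (xs ∩P?) b f w ≡ paint ((x ∷ xs) ∩P?) b f w
          same w≢x = split ((xs ∩P?) w)
            where
            split : Dec (P w × w ∈ xs) → paint (xs ∩P?) b f w ≡ paint ((x ∷ xs) ∩P?) b f w
            split (yes (p , w∈)) = trans (paint-in (xs ∩P?) f (p , w∈))
                                         (sym (paint-in ((x ∷ xs) ∩P?) f (p , there w∈)))
            split (no ¬pw) = trans (paint-out (xs ∩P?) f ¬pw) (sym (paint-out ((x ∷ xs) ∩P?) f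
              λ { (p , here eq) → w≢x eq ; (p , there w∈) → ¬pw (p , w∈) }))
      partial : ∀ xs → Reach S L f (paint (xs ∩P?) b f)
      partial [] = ≈-move (subpaint-proper ([] ∩P?) proj₁)
                     λ _ → sym (paint-out ([] ∩P?) f λ { (_ , ()) })
      partial (x ∷ xs) = partial xs ◅◅ (subpaint-proper ((x ∷ xs) ∩P?) proj₁ , one x xs) ◅ ε
      agree : paint (S ∩P?) b f ≈[ S ] paint P? b f
      agree {v} v∈ = split (P? v)
        where
        split : Dec (P v) → paint (S ∩P?) b f v ≡ paint P? b f v
        split (yes p) = trans (paint-in (S ∩P?) f (p , v∈)) (sym (paint-in P? f p))
        split (no ¬p) = trans (paint-out (S ∩P?) f (¬p ∘ proj₁)) (sym (paint-out P? f ¬p))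

    -- Along the given path `b` never occurs outside `P`, so `P` can keep the color `b` throughout.
    paint-lift : ∀ {f g} → b ∈ L → Independent S P →
      Reach (S ∖ P?) (L ∖ (_≟ b)) f g → Reach S L (paint P? b f) (paint P? b g)
    paint-lift b∈ indep ε = ε
    paint-lift {f} b∈ indep (_◅_ {j = h} (ph , one) rest) =
      (paint-proper P? b∈ indep weaken
        (λ _ v∈ _ ¬p _ → proj₂ (∈-∖⁻ (_≟ b) L (inPalette ph (∈-∖⁺ P? v∈ ¬p)))) , one′)
      ◅ paint-lift b∈ indep rest
      where
      weaken : Proper (S ∖ P?) L h
      weaken = record { inPalette = proj₁ ∘ ∈-∖⁻ (_≟ b) L ∘ inPalette ph ; separates = separates ph }
      one′ : OneChange S (paint P? b f) (paint P? b h)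
      one′ {u} {v} u∈ v∈ with P? u | P? v
      ... | yes _ | _     = λ u≢ → contradiction refl u≢
      ... | no _  | yes _ = λ _ v≢ → contradiction refl v≢
      ... | no ¬p | no ¬q = one (∈-∖⁺ P? u∈ ¬p) (∈-∖⁺ P? v∈ ¬q)

  -- Colorings that miss a color, and the data of a reduction

  Misses : List V → C → (V → C) → Set
  Misses S c f = ∀ {v} → v ∈ S → f v ≢ c

  -- Replaces the hypothesis `ℓ ≥ χ G + 1` in the induction, in a form that survives the deletion of
  -- vertices and colors.
  record Target (S : List V) (L : List C) : Set where
    field
      col    : V → C
      proper : Proper S L col
      spare  : C
      spare∈ : spare ∈ L
      misses : Misses S spare col
  open Target public

  SameColor : (V → C) → V → Pred V 0ℓ
  SameColor f v₀ v = f v ≡ f v₀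

  sameColor? : ∀ f v₀ → Decidable (SameColor f v₀)
  sameColor? f v₀ v = f v ≟ f v₀

  class-independent : ∀ {S L f} → Proper S L f → ∀ {c : C} → Independent S (λ v → f v ≡ c)
  class-independent pf u∈ v∈ eu ev u~v = separates pf u∈ v∈ u~v (trans eu (sym ev))

  -- Transposing b with the color of the removed class keeps the other colors inside L ∖ b.
  peel : ∀ {S L} (t : Target S L) {v₀ b} → v₀ ∈ S → b ∈ L →
         Target (S ∖ sameColor? (col t) v₀) (L ∖ (_≟ b))
  peel {S} {L} t {v₀} {b} v₀∈ b∈ = record
    { col    = τ ∘ col t
    ; proper = record
        { inPalette = inL
        ; separates = λ u∈ v∈ u~v → separates (proper t) (⊆S u∈) (⊆S v∈) u~v ∘ transpose-injective
        }
    ; spare  = τ (spare t)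
    ; spare∈ = ∈-∖⁺ (_≟ b) (transpose-∈ a∈ b∈ (spare∈ t)) (misses t v₀∈ ∘ sym ∘ τ≡b)
    ; misses = λ v∈ → misses t (⊆S v∈) ∘ transpose-injective
    }
    where
    a : C
    a = col t v₀
    τ : C → C
    τ = transpose a b
    a∈ : a ∈ L
    a∈ = inPalette (proper t) v₀∈
    τ≡b : ∀ {x} → τ x ≡ b → x ≡ a
    τ≡b eq = transpose-injective (trans eq (sym (transpose-matches {a = a})))
    ⊆S : ∀ {v} → v ∈ S ∖ sameColor? (col t) v₀ → v ∈ S
    ⊆S = proj₁ ∘ ∈-∖⁻ (sameColor? (col t) v₀) S
    inL : ∀ {v} → v ∈ S ∖ sameColor? (col t) v₀ → τ (col t v) ∈ L ∖ (_≟ b)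
    inL v∈ = let v∈S , ≢a = ∈-∖⁻ (sameColor? (col t) v₀) S v∈ in
      ∈-∖⁺ (_≟ b) (transpose-∈ a∈ b∈ (inPalette (proper t) v∈S)) (≢a ∘ τ≡b)

  -- The absorbing class is named by a member `rep` of `S`, so that removing it makes `S` shorter;
  -- the absorbed class of `color` under `f` may be empty.
  record Absorbed (S : List V) (L : List C) (f : V → C) : Set where
    field
      color     : C
      color∈    : color ∈ L
      target    : Target S L
      rep       : V
      rep∈      : rep ∈ S
      contained : ∀ {v} → v ∈ S → f v ≡ color → SameColor (col target) rep v

  degree : List V → V → ℕ
  degree S u = length (filter (u ~?_) S)

  data Reduction (S : List V) (L : List C) : Set where
    dominated : ∀ {u v} → u ∈ S → v ∈ S → u ≢ v → (∀ {w} → w ∈ S → u ~ w → v ~ w) → Reduction S L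
    lowDegree : ∀ {u} → u ∈ S → 2 + degree S u ≤ length L → Reduction S L
    absorbed  : (∀ {f} → Proper S L f → Absorbed S L f) → Reduction S L

  -- The three reductions

  move-sym : ∀ {S L f g} → Proper S L f → Move S L f g → Move S L g f
  move-sym pf (_ , one) = pf , λ u∈ v∈ u≢ v≢ → one u∈ v∈ (u≢ ∘ sym) (v≢ ∘ sym)

  reach-sym : ∀ {S L f g} → Proper S L f → Reach S L f g → Reach S L g f
  reach-sym pf ε = ε
  reach-sym pf (m ◅ rest) = reach-sym (proj₁ m) rest ◅◅ move-sym pf m ◅ ε

  reach-proper : ∀ {S L f g} → Proper S L f → Reach S L f g → Proper S L g
  reach-proper pf ε = pf
  reach-proper pf (m ◅ rest) = reach-proper (proj₁ m) rest

  shrink : ∀ {S L f} {P : Pred V 0ℓ} (P? : Decidable P) {b : C} → Proper S L f →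
    (∀ {v} → v ∈ S → f v ≡ b → P v) → Proper (S ∖ P?) (L ∖ (_≟ b)) f
  shrink {S} P? {b} pf class⊆P = record
    { inPalette = λ v∈ → let v∈S , ¬p = ∈-∖⁻ P? S v∈ in
        ∈-∖⁺ (_≟ b) (inPalette pf v∈S) (¬p ∘ class⊆P v∈S)
    ; separates = separates (restrict P? pf)
    }

  -- Painting A with the color of B lets the rest be recolored to miss a color; such a free color
  -- allows every coloring to be moved to one in which the class of col t v₀ is that of t.
  absorbed-conn : ∀ {S L} → Target S L → ∀ {v₀} → v₀ ∈ S →
    (∀ {f} → Proper S L f → Absorbed S L f) →
    (∀ {P : Pred V 0ℓ} (P? : Decidable P) {v b} → v ∈ S → P v → b ∈ L →
      Target (S ∖ P?) (L ∖ (_≟ b)) → Conn (S ∖ P?) (L ∖ (_≟ b))) →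
    Conn S L
  absorbed-conn {S} {L} t {v₀} v₀∈ absorb IH {f} {g} pf pg =
    let f′ , qf , f⇝ = normalize pf
        g′ , qg , g⇝ = normalize pg
    in f⇝ ◅◅ paint-lift A? a∈ A-indep (IH A? v₀∈ refl a∈ (peel t v₀∈ a∈) qf qg)
          ◅◅ reach-sym pg g⇝
    where
    a : C
    a = col t v₀
    a∈ : a ∈ L
    a∈ = inPalette (proper t) v₀∈
    A? : Decidable (SameColor (col t) v₀)
    A? = sameColor? (col t) v₀
    A-indep : Independent S (SameColor (col t) v₀)
    A-indep = class-independent (proper t)

    freeColor : ∀ {f} → Proper S L f →
      ∃[ c ] c ∈ L × ∃[ f′ ] Proper S L f′ × Misses S c f′ × Reach S L f f′
    freeColor {f} pf = spare t′ , proj₁ (∈-∖⁻ (_≟ b) L (spare∈ t′)) , _ ,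
                       reach-proper pf f⇝ , missed , f⇝
      where
      open Absorbed (absorb pf) renaming (color to b; color∈ to b∈)
      B? : Decidable (SameColor (col target) rep)
      B? = sameColor? (col target) rep
      B-indep : Independent S (SameColor (col target) rep)
      B-indep = class-independent (proper target)
      t′ : Target (S ∖ B?) (L ∖ (_≟ b))
      t′ = peel target rep∈ b∈
      f⇝ : Reach S L f (paint B? b (col t′))
      f⇝ = paint-reach B? b∈ B-indep pf contained
        ◅◅ paint-lift B? b∈ B-indep (IH B? rep∈ refl b∈ t′ (shrink B? pf contained) (proper t′))
      missed : Misses S (spare t′) (paint B? b (col t′))
      missed {v} v∈ = split (B? v)
        where
        split : Dec (SameColor (col target) rep v) → paint B? b (col t′) v ≢ spare t′
        split (yes p) eq = proj₂ (∈-∖⁻ (_≟ b) L (spare∈ t′)) (trans (sym eq) (paint-in B? (col t′) p))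
        split (no ¬p) eq = misses t′ (∈-∖⁺ B? v∈ ¬p) (trans (sym (paint-out B? (col t′) ¬p)) eq)

    normalize : ∀ {f} → Proper S L f →
      ∃[ f′ ] Proper (S ∖ A?) (L ∖ (_≟ a)) f′ × Reach S L f (paint A? a f′)
    normalize pf with c , c∈ , h , ph , h-misses , f⇝h ← freeColor pf =
      h′ , shrink A? ph′ (λ v∈ eq → contradiction eq (h′-misses v∈)) ,
      f⇝h ◅◅ h⇝h′ ◅◅ paint-reach A? a∈ A-indep ph′ (λ v∈ eq → contradiction eq (h′-misses v∈))
      where
      a? : Decidable (λ v → h v ≡ a)
      a? v = h v ≟ a
      h′ : V → C
      h′ = paint a? c h
      h⇝h′ : Reach S L h h′
      h⇝h′ = paint-reach a? c∈ (class-independent ph) ph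
               (λ v∈ eq → contradiction eq (h-misses v∈))
      ph′ : Proper S L h′
      ph′ = reach-proper ph h⇝h′
      h′-misses : Misses S a h′
      h′-misses {v} v∈ with h v ≟ a
      ... | yes hv≡a = λ c≡a → h-misses v∈ (trans hv≡a (sym c≡a))
      ... | no hv≢a = hv≢a

  -- Deleting a single vertex

  module _ {S : List V} {L : List C} {u : V} where

    private
      S′ : List V
      S′ = S ∖ (_≟ u)

      adjust : ∀ {f g} → Proper S L g → f ≈[ S′ ] g → Reach S L f g
      adjust {f} {g} pg f≈g = (pg , λ v∈ w∈ v≢ w≢ → trans (at-u v∈ v≢) (sym (at-u w∈ w≢))) ◅ ε
        where
        at-u : ∀ {v} → v ∈ S → f v ≢ g v → v ≡ u
        at-u {v} v∈ v≢ = decidable-stable (v ≟ u) (v≢ ∘ f≈g ∘ ∈-∖⁺ (_≟ u) v∈)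

    -- A path in S ∖ u lifts to S if each of its moves does, I being an invariant of the lifts.
    delete-conn : (I : Pred (V → C) 0ℓ) → Conn S′ L →
      (∀ {f g} → Proper S L f → I f → Move S′ L f g →
        ∃[ h ] Proper S L h × I h × (h ≈[ S′ ] g) × Reach S L f h) →
      ∀ {f g} → Proper S L f → I f → Proper S L g → Reach S L f g
    delete-conn I conn′ step pf If pg =
      let h , h≈g , f⇝h = follow pf If (λ _ → refl) (conn′ (restrict (_≟ u) pf) (restrict (_≟ u) pg))
      in f⇝h ◅◅ adjust pg h≈g
      where
      follow : ∀ {f f′ g} → Proper S L f → I f → f ≈[ S′ ] f′ → Reach S′ L f′ g →
               ∃[ h ] (h ≈[ S′ ] g) × Reach S L f h
      follow pf If f≈ ε = _ , f≈ , ε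
      follow {f} {f′} pf If f≈ ((ph , one) ◅ rest) =
        let h , ph′ , Ih , h≈ , f⇝h = step pf If (ph , λ v∈ w∈ v≢ w≢ →
              one v∈ w∈ (v≢ ∘ trans (f≈ v∈)) (w≢ ∘ trans (f≈ w∈)))
            k , k≈ , h⇝k = follow ph′ Ih h≈ rest
        in k , k≈ , f⇝h ◅◅ h⇝k

    private
      set : C → (V → C) → V → C
      set = paint (_≟ u)

      set-≈ : ∀ {e} f → set e f ≈[ S′ ] f
      set-≈ f v∈ = paint-out (_≟ u) f (proj₂ (∈-∖⁻ (_≟ u) S v∈))

      set-proper : ∀ {e f} → e ∈ L → Proper S′ L f →
        (∀ {v} → v ∈ S → u ~ v → f v ≢ e) → Proper S L (set e f)
      set-proper e∈ pf e-fits = paint-proper (_≟ u) e∈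
        (λ { _ _ refl refl → ~-irr refl }) pf (λ { _ v∈ refl _ → e-fits v∈ })

      set-move : ∀ {f g} → Proper S L (set (f u) g) → Move S′ L f g → Reach S L f (set (f u) g)
      set-move {f} {g} p (_ , one) = (p , λ v∈ w∈ v≢ w≢ →
        one (inS′ v∈ v≢) (inS′ w∈ w≢) (moved v≢) (moved w≢)) ◅ ε
        where
        not-u : ∀ {v} → f v ≢ set (f u) g v → v ≢ u
        not-u v≢ refl = v≢ (sym (paint-in (_≟ u) g refl))
        inS′ : ∀ {v} → v ∈ S → f v ≢ set (f u) g v → v ∈ S′
        inS′ v∈ v≢ = ∈-∖⁺ (_≟ u) v∈ (not-u v≢)
        moved : ∀ {v} → f v ≢ set (f u) g v → f v ≢ g v
        moved v≢ eq = v≢ (trans eq (sym (paint-out (_≟ u) g (not-u v≢))))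

      nbr-in : ∀ {v} → v ∈ S → u ~ v → v ∈ S′
      nbr-in v∈ u~v = ∈-∖⁺ (_≟ u) v∈ λ { refl → ~-irr refl u~v }

    -- u imitates the vertex v that dominates it.
    dominated-conn : ∀ {v} → u ∈ S → v ∈ S → u ≢ v → (∀ {w} → w ∈ S → u ~ w → v ~ w) →
      Conn S′ L → Conn S L
    dominated-conn {v} u∈ v∈ u≢v dom conn′ {f} pf pg =
      adjust pf′ (sym ∘ set-≈ f) ◅◅ delete-conn (λ h → h u ≡ h v) conn′ step pf′ (agree f) pg
      where
      imitate : ∀ {h} → Proper S′ L h → Proper S L (set (h v) h)
      imitate ph = set-proper (inPalette ph v∈′) ph
        (λ w∈ u~w → separates ph v∈′ (nbr-in w∈ u~w) (dom w∈ u~w) ∘ sym)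
        where
        v∈′ : v ∈ S′
        v∈′ = ∈-∖⁺ (_≟ u) v∈ (u≢v ∘ sym)
      agree : ∀ h → set (h v) h u ≡ set (h v) h v
      agree h = trans (paint-in (_≟ u) h refl) (sym (paint-out (_≟ u) h (u≢v ∘ sym)))
      pf′ : Proper S L (set (f v) f)
      pf′ = imitate (restrict (_≟ u) pf)
      step : ∀ {f g} → Proper S L f → f u ≡ f v → Move S′ L f g →
        ∃[ h ] Proper S L h × (h u ≡ h v) × (h ≈[ S′ ] g) × Reach S L f h
      step {f} {g} pf fu≡fv m@(pg , one) =
        set (g v) g , imitate pg , agree g , set-≈ g ,
        -- The move is made first with the color of `u` unchanged; then `u` follows `v`.
        set-move pm m ◅◅ adjust (imitate pg) (λ w∈ → trans (set-≈ g w∈) (sym (set-≈ g w∈)))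
        where
        v∈′ : v ∈ S′
        v∈′ = ∈-∖⁺ (_≟ u) v∈ (u≢v ∘ sym)
        -- A neighbor `w` of `u` that has the color of `u` after the move must be the vertex that
        -- moved. Then `v` kept that same color, yet `w` is adjacent to `v`.
        fits : ∀ {w} → w ∈ S → u ~ w → g w ≢ f u
        fits {w} w∈ u~w gw≡fu with f w ≟ g w
        ... | yes fw≡gw = separates pf u∈ w∈ u~w (sym (trans fw≡gw gw≡fu))
        ... | no fw≢gw = separates pg v∈′ (nbr-in w∈ u~w) (dom w∈ u~w) (sym gw≡gv)
          where
          fv≡gv : f v ≡ g v
          fv≡gv = decidable-stable (f v ≟ g v) λ fv≢gv →
            ~-irr (one v∈′ (nbr-in w∈ u~w) fv≢gv fw≢gw) (dom w∈ u~w)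
          gw≡gv : g w ≡ g v
          gw≡gv = trans gw≡fu (trans fu≡fv fv≡gv)
        pm : Proper S L (set (f u) g)
        pm = set-proper (inPalette pf u∈) pg fits

    -- A move obstructs only if it gives a neighbor `t` the color of `u`; in that case `u` first
    -- changes to a color that suits its neighbors both before and after the move.
    lowDegree-conn : u ∈ S → Unique L → 2 + degree S u ≤ length L → Conn S′ L → Conn S L
    lowDegree-conn u∈ uniq low conn′ pf pg = delete-conn (λ _ → ⊤) conn′ step pf tt pg
      where
      nbrs : List V
      nbrs = filter (u ~?_) S
      nbr⁺ : ∀ {w} → w ∈ S → u ~ w → w ∈ nbrs
      nbr⁺ = ∈-filter⁺ (u ~?_)
      step : ∀ {f g} → Proper S L f → ⊤ → Move S′ L f g →
        ∃[ h ] Proper S L h × ⊤ × (h ≈[ S′ ] g) × Reach S L f h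
      step {f} {g} pf _ m@(pg , one) with search (λ w → (u ~? w) ×-dec (g w ≟ f u)) S
      ... | inj₂ none = set (f u) g , pk , tt , set-≈ g , set-move pk m
        where
        pk : Proper S L (set (f u) g)
        pk = set-proper (inPalette pf u∈) pg (λ w∈ u~w eq → none w∈ (u~w , eq))
      ... | inj₁ (t , t∈ , u~t , gt≡fu)
        -- The forbidden colors are the old ones of the neighbors and the new one of `t`: at most
        -- one more than the degree, hence fewer than the palette has.
        with e , e∈ , e∉ ← fresh _≟_ {xs = g t ∷ map f nbrs} uniq
                             (subst (λ k → 2 + k ≤ length L) (sym (length-map f nbrs)) low) =
        set e g , pk , tt , set-≈ g , adjust ph (sym ∘ set-≈ f) ◅◅ moved
        where
        f-fits : ∀ {w} → w ∈ S → u ~ w → f w ≢ e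
        f-fits w∈ u~w fw≡e = e∉ (there (subst (_∈ map f nbrs) fw≡e (∈-map⁺ f (nbr⁺ w∈ u~w))))
        ft≢gt : f t ≢ g t
        ft≢gt eq = separates pf u∈ t∈ u~t (sym (trans eq gt≡fu))
        g-fits : ∀ {w} → w ∈ S → u ~ w → g w ≢ e
        g-fits {w} w∈ u~w gw≡e with f w ≟ g w
        ... | yes fw≡gw = f-fits w∈ u~w (trans fw≡gw gw≡e)
        ... | no fw≢gw = e∉ (here (trans (sym gw≡e)
                (cong g (one (nbr-in w∈ u~w) (nbr-in t∈ u~t) fw≢gw ft≢gt))))
        ph : Proper S L (set e f)
        ph = set-proper e∈ (restrict (_≟ u) pf) f-fits
        pk : Proper S L (set e g)
        pk = set-proper e∈ pg g-fits
        set-cong : ∀ {v} → set e f v ≢ set e g v → v ≢ u × f v ≢ g v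
        set-cong {v} v≢ with v ≟ u
        ... | yes _ = contradiction refl v≢
        ... | no v≢u = v≢u , v≢
        moved : Reach S L (set e f) (set e g)
        moved = (pk , λ v∈ w∈ v≢ w≢ →
          let v≢u , fv≢ = set-cong v≢ ; w≢u , fw≢ = set-cong w≢
          in one (∈-∖⁺ (_≟ u) v∈ v≢u) (∈-∖⁺ (_≟ u) w∈ w≢u) fv≢ fw≢) ◅ ε

  restrictTarget : ∀ {S L} {P : Pred V 0ℓ} (P? : Decidable P) → Target S L → Target (S ∖ P?) L
  restrictTarget {S} P? t = record
    { col = col t ; proper = restrict P? (proper t) ; spare = spare t ; spare∈ = spare∈ t
    ; misses = misses t ∘ proj₁ ∘ ∈-∖⁻ P? S }

  -- Induction on the number of vertices

  module _ (reduce : ∀ {S L} → Unique S → Unique L → ∀ {v} → v ∈ S → Target S L → Reduction S L) where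

    -- Every reduction removes at least one vertex, so `n` bounds the recursion. After a deletion
    -- the target is restricted; after an absorption `absorbed-conn` supplies a new one.
    reducible-conn : ∀ n {S L} → length S < n → Unique S → Unique L → Target S L → Conn S L
    reducible-conn (suc n) {[]} _ _ _ _ pf pg = ≈-move pg λ ()
    reducible-conn (suc n) {S@(_ ∷ _)} {L} (s≤s S≤n) uS uL t with reduce uS uL (here refl) t
    ... | dominated {u} u∈ v∈ u≢v dom = dominated-conn u∈ v∈ u≢v dom
            (reducible-conn n (<-≤-trans (∖-length-< (_≟ u) u∈ refl) S≤n)
              (Unique.filter⁺ (¬? ∘ (_≟ u)) uS) uL (restrictTarget (_≟ u) t))
    ... | lowDegree {u} u∈ low = lowDegree-conn u∈ uL low
            (reducible-conn n (<-≤-trans (∖-length-< (_≟ u) u∈ refl) S≤n)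
              (Unique.filter⁺ (¬? ∘ (_≟ u)) uS) uL (restrictTarget (_≟ u) t))
    ... | absorbed absorb = absorbed-conn t (here refl) absorb
            λ P? v∈ pv b∈ → reducible-conn n (<-≤-trans (∖-length-< P? v∈ pv) S≤n)
              (Unique.filter⁺ (¬? ∘ P?) uS) (Unique.filter⁺ (¬? ∘ (_≟ _)) uL)

-- Forbidden induced subgraphs

lookup-pairs : ∀ {A : Set} {R : Rel A 0ℓ} {n} {f : Fin n → A} → AllPairs R (List.tabulate f) →
  ∀ {i j} → i Fin.< j → R (f i) (f j)
lookup-pairs {n = suc n} (r ∷ _) {Fin.zero} {Fin.suc j} _ = All.tabulate⁻ r j
lookup-pairs {n = suc n} (_ ∷ rs) {Fin.suc i} {Fin.suc j} (s≤s i<j) = lookup-pairs rs i<j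

module Patterns (G : Graph) where
  open Graph G using (_~_; _~?_; ~-sym; ~-irr)

  module _ (H : Graph) (f : Vertex H → Vertex G) where
    open Graph H using () renaming (_~_ to _~ᴴ_; _~?_ to _~ᴴ?_; ~-sym to ~ᴴ-sym; ~-irr to ~ᴴ-irr)

    -- Branching on `does` makes this compute for a concrete `H`, so an `AllPairs` proof is simply
    -- the list of edges and non-edges among the chosen vertices.
    Matches : Rel (Vertex H) 0ℓ
    Matches u v = if does (u ~ᴴ? v) then f u ~ f v else (f u ≢ f v × ¬ f u ~ f v)

    matches⇒⇔ : ∀ {u v} → Matches u v → f u ≢ f v × (u ~ᴴ v ⇔ f u ~ f v)
    matches⇒⇔ {u} {v} m with u ~ᴴ? v
    ... | yes u~v = (λ eq → ~-irr eq m) , mk⇔ (λ _ → m) (λ _ → u~v)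
    ... | no u≁v  = proj₁ m , mk⇔ (λ u~v → contradiction u~v u≁v) (λ fu~fv → contradiction fu~fv (proj₂ m))

    inducedCopy : AllPairs Matches (allFin (order H)) → InducedCopy H G
    inducedCopy pairs = record { f = f ; injective = inj _ _ ; adjacent = adj }
      where
      lt : ∀ {u v} → u Fin.< v → f u ≢ f v × (u ~ᴴ v ⇔ f u ~ f v)
      lt u<v = matches⇒⇔ (lookup-pairs pairs u<v)
      inj : ∀ u v → f u ≡ f v → u ≡ v
      inj u v eq with Fin.<-cmp u v
      ... | tri< u<v _ _ = contradiction eq (proj₁ (lt u<v))
      ... | tri≈ _ u≡v _ = u≡v
      ... | tri> _ _ v<u = contradiction (sym eq) (proj₁ (lt v<u))
      adj : ∀ u v → u ~ᴴ v ⇔ f u ~ f v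
      adj u v with Fin.<-cmp u v
      ... | tri< u<v _ _ = proj₂ (lt u<v)
      ... | tri≈ _ refl _ = mk⇔ (λ u~u → contradiction u~u (~ᴴ-irr refl))
                                (λ u~u → contradiction u~u (~-irr refl))
      ... | tri> _ _ v<u = mk⇔ (~-sym ∘ Equivalence.to (proj₂ (lt v<u)) ∘ ~ᴴ-sym)
                               (~ᴴ-sym ∘ Equivalence.from (proj₂ (lt v<u)) ∘ ~-sym)

  _≁_ : Rel (Vertex G) 0ℓ
  u ≁ v = ¬ u ~ v

  ≁-sym : ∀ {u v} → u ≁ v → v ≁ u
  ≁-sym = _∘ ~-sym

  -- Distinctness is assumed for exactly those pairs that the listed edges and non-edges do not
  -- already tell apart.
  No2K₂ NoPaw NoClaw NoDiamond : Set
  No2K₂     = ∀ {a b c d} → a ~ b → c ~ d → a ≁ c → a ≁ d → b ≁ c → b ≁ d → ⊥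
  NoPaw     = ∀ {a b c d} → a ~ b → a ~ c → b ~ c → a ~ d → b ≁ d → c ≁ d → ⊥
  NoClaw    = ∀ {a b c d} → a ~ b → a ~ c → a ~ d → b ≢ c → b ≢ d → c ≢ d →
              b ≁ c → b ≁ d → c ≁ d → ⊥
  NoDiamond = ∀ {a b c d} → a ~ b → a ~ c → a ~ d → b ~ c → b ~ d → c ≢ d → c ≁ d → ⊥

  apart : ∀ {u v w} → u ~ v → w ≁ v → u ≢ w
  apart u~v w≁v refl = w≁v u~v

  no2K₂ : ¬ InducedCopy 2K₂ G → No2K₂
  no2K₂ free {a} {b} {c} {d} a~b c~d a≁c a≁d b≁c b≁d =
    free (inducedCopy 2K₂ (lookup (a ∷ b ∷ c ∷ d ∷ []))
      ((a~b ∷ (apart a~b (≁-sym b≁c) , a≁c) ∷ (apart a~b (≁-sym b≁d) , a≁d) ∷ []) ∷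
       ((apart (~-sym a~b) (≁-sym a≁c) , b≁c) ∷ (apart (~-sym a~b) (≁-sym a≁d) , b≁d) ∷ []) ∷
       (c~d ∷ []) ∷ [] ∷ []))

  noPaw : ¬ InducedCopy paw G → NoPaw
  noPaw free {a} {b} {c} {d} a~b a~c b~c a~d b≁d c≁d =
    free (inducedCopy paw (lookup (a ∷ b ∷ c ∷ d ∷ []))
      ((a~b ∷ a~c ∷ a~d ∷ []) ∷
       (b~c ∷ (apart b~c (≁-sym c≁d) , b≁d) ∷ []) ∷
       ((apart (~-sym b~c) (≁-sym b≁d) , c≁d) ∷ []) ∷ [] ∷ []))

  -- A paw contains a triangle, so the triangle case is treated as part of the paw case.
  noPaw-triangle : ¬ InducedCopy triangle G → NoPaw
  noPaw-triangle free {a} {b} {c} a~b a~c b~c _ _ _ =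
    free (inducedCopy triangle (lookup (a ∷ b ∷ c ∷ []))
      ((a~b ∷ a~c ∷ []) ∷ (b~c ∷ []) ∷ [] ∷ []))

  noClaw : ¬ InducedCopy claw G → NoClaw
  noClaw free {a} {b} {c} {d} a~b a~c a~d b≢c b≢d c≢d b≁c b≁d c≁d =
    free (inducedCopy claw (lookup (a ∷ b ∷ c ∷ d ∷ []))
      ((a~b ∷ a~c ∷ a~d ∷ []) ∷ ((b≢c , b≁c) ∷ (b≢d , b≁d) ∷ []) ∷ ((c≢d , c≁d) ∷ []) ∷ [] ∷ []))

  noDiamond : ¬ InducedCopy diamond G → NoDiamond
  noDiamond free {a} {b} {c} {d} a~b a~c a~d b~c b~d c≢d c≁d =
    free (inducedCopy diamond (lookup (a ∷ b ∷ c ∷ d ∷ []))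
      ((a~b ∷ a~c ∷ a~d ∷ []) ∷ (b~c ∷ b~d ∷ []) ∷ ((c≢d , c≁d) ∷ []) ∷ [] ∷ []))

-- Reductions in (2K₂, H)-free graphs

module Structure (G : Graph) (ℓ : ℕ) where
  open Graph G using (_~_; _~?_; ~-sym; ~-irr)
  open Recoloring G ℓ
  open Patterns G

  Incomparable : List V → Set
  Incomparable S = ∀ {u v} → u ∈ S → v ∈ S → u ≢ v → ∃[ w ] w ∈ S × u ~ w × v ≁ w

  dominated⊎incomparable : ∀ S {L} → Reduction S L ⊎ Incomparable S
  dominated⊎incomparable S with search (λ u → Any.any? (λ v →
      ¬? (u ≟ v) ×-dec All.all? (λ w → (u ~? w) →-dec (v ~? w)) S) S) S
  ... | inj₁ (u , u∈ , found) = let v , v∈ , u≢v , dom = find found in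
          inj₁ (dominated u∈ v∈ u≢v (All.lookup dom))
  ... | inj₂ none = inj₂ private-nbr
    where
    private-nbr : Incomparable S
    private-nbr {u} {v} u∈ v∈ u≢v with search (λ w → (u ~? w) ×-dec ¬? (v ~? w)) S
    ... | inj₁ found = found
    ... | inj₂ no-w = contradiction
            (lose v∈ (u≢v , All.tabulate λ {w} w∈ u~w → decidable-stable (v ~? w)
              λ v≁w → no-w w∈ (u~w , v≁w)))
            (none u∈)

  -- Common tools when no two neighborhoods are comparable

  module Reduce (no2K₂ : No2K₂) {S : List V} {L : List C} (uniqS : Unique S) (uniqL : Unique L)
                {v₀ : V} (v₀∈ : v₀ ∈ S) (t : Target S L) (inc : Incomparable S) where

    α : V → C
    α = col t

    -- The colors left to `α`. Counting against `K` instead of `L` gains the one color that the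
    -- degree bounds rely on.
    K : List C
    K = L ∖ (_≟ spare t)

    K<L : length K < length L
    K<L = ∖-length-< (_≟ spare t) (spare∈ t) refl

    α∈K : ∀ {v} → v ∈ S → α v ∈ K
    α∈K v∈ = ∈-∖⁺ (_≟ spare t) (inPalette (proper t) v∈) (misses t v∈)

    α-≢ : ∀ {u v} → u ∈ S → v ∈ S → u ~ v → α u ≢ α v
    α-≢ = separates (proper t)

    -- The fourth color is `spare t`, which `α` misses.
    four-colors : ∀ {u v w} → u ∈ S → v ∈ S → w ∈ S → α u ≢ α v → α u ≢ α w → α v ≢ α w →
                  4 ≤ length L
    four-colors u∈ v∈ w∈ u≢v u≢w v≢w = ⊆-length _≟_
      ((≢-sym (misses t u∈) ∷ ≢-sym (misses t v∈) ∷ ≢-sym (misses t w∈) ∷ []) ∷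
       (u≢v ∷ u≢w ∷ []) ∷ (v≢w ∷ []) ∷ [] ∷ [])
      (All.lookup (spare∈ t ∷ inPalette (proper t) u∈ ∷ inPalette (proper t) v∈ ∷
                   inPalette (proper t) w∈ ∷ []))

    joined : ∀ {a b c d} → a ~ b → c ~ d → a ≁ c → a ≁ d → b ≁ c → b ~ d
    joined {b = b} {d = d} a~b c~d a≁c a≁d b≁c =
      decidable-stable (b ~? d) (no2K₂ a~b c~d a≁c a≁d b≁c)

    -- Incomparability gives each of `u` and `v` a private neighbor, and 2K₂-freeness joins these
    -- two: the result is an induced path `u x y v`.
    crossing : ∀ {u v} → u ∈ S → v ∈ S → u ≢ v → u ≁ v →
      ∃[ x ] ∃[ y ] x ∈ S × y ∈ S × u ~ x × v ≁ x × v ~ y × u ≁ y × x ~ y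
    crossing u∈ v∈ u≢v u≁v =
      let x , x∈ , u~x , v≁x = inc u∈ v∈ u≢v
          y , y∈ , v~y , u≁y = inc v∈ u∈ (≢-sym u≢v)
      in x , y , x∈ , y∈ , u~x , v≁x , v~y , u≁y , joined u~x v~y u≁v u≁y (≁-sym v≁x)

    Nbrs : V → List V
    Nbrs u = filter (u ~?_) S

    ∈-Nbrs⁻ : ∀ {u v} → v ∈ Nbrs u → v ∈ S × u ~ v
    ∈-Nbrs⁻ {u} = ∈-filter⁻ (u ~?_) {xs = S}

    clique-length : ∀ {T} → Unique T → T ⊆ S → (∀ {x y} → x ∈ T → y ∈ T → x ≢ y → x ~ y) →
                    length T ≤ length K
    clique-length uniq T⊆S clique = subst (_ ≤_) (*-identityʳ _)
      (length-≤-by-fibres _≟_ α K uniq (α∈K ∘ T⊆S) λ u zs⊆T same →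
        length≤1 u λ {x} {y} x∈ y∈ → decidable-stable (x ≟ y) λ x≢y →
          α-≢ (T⊆S (zs⊆T x∈)) (T⊆S (zs⊆T y∈)) (clique (zs⊆T x∈) (zs⊆T y∈) x≢y)
              (trans (same x∈) (sym (same y∈))))

    -- `x` and the neighbors of `u` form a clique, on which `α` is injective. So the degree of `u`
    -- plus one is at most the length of `K`, which is less than that of `L`.
    clique-lowDegree : ∀ {u x} → u ∈ S → x ∈ S → u ≁ x →
      (∀ {y} → y ∈ S → u ~ y → x ~ y) →
      (∀ {y z} → y ∈ S → z ∈ S → u ~ y → u ~ z → y ≢ z → y ~ z) → Reduction S L
    clique-lowDegree {u} {x} u∈ x∈ u≁x complete clique =
      lowDegree u∈ (≤-trans (s≤s (clique-length uniq ⊆S clique′)) K<L)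
      where
      uniq : Unique (x ∷ Nbrs u)
      uniq = All.tabulate (λ { y∈ refl → u≁x (proj₂ (∈-Nbrs⁻ y∈)) }) ∷ Unique.filter⁺ (u ~?_) uniqS
      ⊆S : x ∷ Nbrs u ⊆ S
      ⊆S (here refl) = x∈
      ⊆S (there y∈) = proj₁ (∈-Nbrs⁻ y∈)
      clique′ : ∀ {y z} → y ∈ x ∷ Nbrs u → z ∈ x ∷ Nbrs u → y ≢ z → y ~ z
      clique′ (here refl) (here refl) y≢z = contradiction refl y≢z
      clique′ (here refl) (there z∈) _ = let z∈S , u~z = ∈-Nbrs⁻ z∈ in complete z∈S u~z
      clique′ (there y∈) (here refl) _ = let y∈S , u~y = ∈-Nbrs⁻ y∈ in ~-sym (complete y∈S u~y)
      clique′ (there y∈) (there z∈) y≢z =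
        let y∈S , u~y = ∈-Nbrs⁻ y∈ ; z∈S , u~z = ∈-Nbrs⁻ z∈ in clique y∈S z∈S u~y u~z y≢z

    NonEdge : Set
    NonEdge = ∃[ a ] ∃[ b ] a ∈ S × b ∈ S × a ≢ b × a ≁ b

    nonEdge⊎reduction : NonEdge ⊎ Reduction S L
    nonEdge⊎reduction with search (λ a → Any.any? (λ b → ¬? (a ≟ b) ×-dec ¬? (a ~? b)) S) S
    ... | inj₁ (a , a∈ , found) = let b , b∈ , a≢b , a≁b = find found in
            inj₁ (a , b , a∈ , b∈ , a≢b , a≁b)
    -- All distinct vertices are adjacent, so `v₀` itself extends its neighborhood to a clique.
    ... | inj₂ none = inj₂ (clique-lowDegree v₀∈ v₀∈ (~-irr refl) (λ _ → id)
            λ {y} {z} y∈ z∈ _ _ y≢z → decidable-stable (y ~? z)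
              λ y≁z → none y∈ (lose z∈ (y≢z , y≁z)))

    record Triangle : Set where
      constructor △
      field
        {x y z} : V
        x∈  : x ∈ S
        y∈  : y ∈ S
        z∈  : z ∈ S
        x~y : x ~ y
        x~z : x ~ z
        y~z : y ~ z

    triangle? : Triangle ⊎ ¬ Triangle
    triangle? with search (λ x → Any.any? (λ y → Any.any? (λ z →
                     (x ~? y) ×-dec (x ~? z) ×-dec (y ~? z)) S) S) S
    ... | inj₁ (x , x∈ , found) =
            let y , y∈ , found′ = find found
                z , z∈ , x~y , x~z , y~z = find found′
            in inj₁ (△ x∈ y∈ z∈ x~y x~z y~z)
    ... | inj₂ none = inj₂ λ { (△ x∈ y∈ z∈ x~y x~z y~z) →
            none x∈ (lose y∈ (lose z∈ (x~y , x~z , y~z))) }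

    -- Without triangles S is a C₅: two nonadjacent vertices a, b lie on a five-cycle a x y b c,
    -- and any further neighbor of a would be comparable with x or with c.
    module TriangleFree (no△ : ¬ Triangle) where

      -- Otherwise `w` has a neighbor `p` that `x` lacks. If `p` is adjacent to `b`, the edges `a x`
      -- and `p b` form a 2K₂; if not, `p` is adjacent to `c`, and `x y` and `p c` form one.
      twin : ∀ {a x y b c w} → a ∈ S → x ∈ S → y ∈ S → b ∈ S → c ∈ S → w ∈ S →
        a ~ x → x ~ y → y ~ b → b ~ c → c ~ a → w ~ a → w ~ y → w ≡ x
      twin {x = x} {b = b} {w = w} a∈ x∈ y∈ b∈ c∈ w∈ a~x x~y y~b b~c c~a w~a w~y =
        decidable-stable (w ≟ x) λ w≢x → let p , p∈ , w~p , x≁p = inc w∈ x∈ w≢x in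
          excluded p∈ w~p x≁p
        where
        a≁b : _
        a≁b = λ a~b → no△ (△ b∈ c∈ a∈ b~c (~-sym a~b) c~a)
        x≁b : _
        x≁b = λ x~b → no△ (△ x∈ y∈ b∈ x~y x~b y~b)
        x≁c : _
        x≁c = λ x~c → no△ (△ c∈ a∈ x∈ c~a (~-sym x~c) a~x)
        y≁c : _
        y≁c = λ y~c → no△ (△ y∈ b∈ c∈ y~b y~c b~c)
        w≁b : _
        w≁b = λ w~b → no△ (△ w∈ y∈ b∈ w~y w~b y~b)
        w≁c : _
        w≁c = λ w~c → no△ (△ w∈ c∈ a∈ w~c w~a c~a)
        excluded : ∀ {p} → p ∈ S → w ~ p → x ≁ p → ⊥
        excluded {p} p∈ w~p x≁p with p ~? b
        ... | yes p~b = no2K₂ a~x p~b a≁p a≁b x≁p x≁b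
          where
          a≁p : _
          a≁p = λ a~p → no△ (△ w∈ a∈ p∈ w~a w~p a~p)
        ... | no p≁b = no2K₂ x~y (joined w~p b~c w≁b w≁c p≁b) x≁p x≁c y≁p y≁c
          where
          y≁p : _
          y≁p = λ y~p → no△ (△ w∈ y∈ p∈ w~y w~p y~p)

      reduction : NonEdge → Reduction S L
      reduction (a , b , a∈ , b∈ , a≢b , a≁b)
        with x , y , x∈ , y∈ , a~x , b≁x , b~y , a≁y , x~y ← crossing a∈ b∈ a≢b a≁b
        with c , c∈ , b~c , x≁c ← inc b∈ x∈ (λ { refl → a≁b a~x }) =
        lowDegree a∈ (≤-trans (+-monoʳ-≤ 2 degree≤2) 4≤L)
        where
        c~a : c ~ a
        c~a = ~-sym (joined (~-sym a~x) b~c (≁-sym b≁x) x≁c a≁b)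
        nbrs-a : Nbrs a ⊆ x ∷ c ∷ []
        -- A neighbor of `a` adjacent to `y` is a twin of `x`; any other is adjacent to `b`, hence a
        -- twin of `c` on the cycle read backwards.
        nbrs-a {w} w∈ with w∈S , a~w ← ∈-Nbrs⁻ w∈ with w ~? y
        ... | yes w~y = here (twin a∈ x∈ y∈ b∈ c∈ w∈S a~x x~y (~-sym b~y) b~c c~a (~-sym a~w) w~y)
        ... | no w≁y = there (here (twin a∈ c∈ b∈ y∈ x∈ w∈S (~-sym c~a) (~-sym b~c) b~y
                         (~-sym x~y) (~-sym a~x) (~-sym a~w)
                         (joined a~w (~-sym b~y) a≁y a≁b w≁y)))
        degree≤2 : degree S a ≤ 2
        degree≤2 = ⊆-length _≟_ (Unique.filter⁺ (a ~?_) uniqS) nbrs-a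
        4≤L : 4 ≤ length L
        -- An odd cycle shows three colors: on `a`, `x`, `y`, or on `a`, `b`, `c` when `a` and `y`
        -- agree.
        4≤L with α a ≟ α y
        ... | no αa≢αy = four-colors a∈ x∈ y∈ (α-≢ a∈ x∈ a~x) αa≢αy (α-≢ x∈ y∈ x~y)
        ... | yes αa≡αy = four-colors a∈ b∈ c∈
                (λ eq → α-≢ b∈ y∈ b~y (trans (sym eq) αa≡αy))
                (α-≢ c∈ a∈ c~a ∘ sym) (α-≢ b∈ c∈ b~c)

    -- Paw-free graphs

    module PawFree (noPaw : NoPaw) where

      -- If `w` sees only `z`, this is a paw. If it sees no corner, a neighbor `p` of `w` that `x`
      -- lacks is adjacent to `y` and `z` by 2K₂-freeness, and `p`, `y`, `z`, `w` form a paw.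
      touches : ∀ {x y z w} → x ∈ S → y ∈ S → z ∈ S → x ~ y → x ~ z → y ~ z → w ∈ S →
                x ≁ w → y ≁ w → ⊥
      touches {z = z} {w} x∈ y∈ z∈ x~y x~z y~z w∈ x≁w y≁w with z ~? w
      ... | yes z~w = noPaw (~-sym x~z) (~-sym y~z) x~y z~w x≁w y≁w
      ... | no z≁w with p , p∈ , w~p , x≁p ← inc w∈ x∈ (λ { refl → y≁w (~-sym x~y) }) =
        noPaw p~y p~z y~z (~-sym w~p) y≁w z≁w
        where
        p~y : _
        p~y = joined w~p x~y (≁-sym x≁w) (≁-sym y≁w) (≁-sym x≁p)
        p~z : _
        p~z = joined w~p x~z (≁-sym x≁w) (≁-sym z≁w) (≁-sym x≁p)

      onTriangle : Triangle → ∀ {a} → a ∈ S →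
        ∃[ p ] ∃[ q ] p ∈ S × q ∈ S × a ~ p × a ~ q × p ~ q
      onTriangle (△ {x} {y} {z} x∈ y∈ z∈ x~y x~z y~z) {a} a∈ with x ~? a | y ~? a | z ~? a
      ... | yes x~a | yes y~a | _ = x , y , x∈ , y∈ , ~-sym x~a , ~-sym y~a , x~y
      ... | yes x~a | no _ | yes z~a = x , z , x∈ , z∈ , ~-sym x~a , ~-sym z~a , x~z
      ... | no _ | yes y~a | yes z~a = y , z , y∈ , z∈ , ~-sym y~a , ~-sym z~a , y~z
      ... | no x≁a | no y≁a | _ = contradiction y≁a (touches x∈ y∈ z∈ x~y x~z y~z a∈ x≁a)
      ... | no x≁a | yes _ | no z≁a =
              contradiction z≁a (touches x∈ z∈ y∈ x~z x~y (~-sym y~z) a∈ x≁a)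
      ... | yes _ | no y≁a | no z≁a =
              contradiction z≁a (touches y∈ z∈ x∈ y~z (~-sym x~y) (~-sym x~z) a∈ y≁a)

      -- Let `a p q` be a triangle and `x` a neighbor of `a` but not of `b`. If `x` is adjacent to
      -- `p` or `q`, then `b` misses two corners of a triangle on the edge `a x`; if not, `x` misses
      -- two corners of `a p q`.
      clique : Triangle → ¬ NonEdge
      clique T (a , b , a∈ , b∈ , a≢b , a≁b)
        with p , q , p∈ , q∈ , a~p , a~q , p~q ← onTriangle T a∈
        with x , x∈ , a~x , b≁x ← inc a∈ b∈ a≢b
        with p ~? x
      ... | yes p~x = touches a∈ x∈ p∈ a~x a~p (~-sym p~x) b∈ a≁b (≁-sym b≁x)
      ... | no p≁x with q ~? x
      ...   | yes q~x = touches a∈ x∈ q∈ a~x a~q (~-sym q~x) b∈ a≁b (≁-sym b≁x)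
      ...   | no q≁x = touches p∈ q∈ a∈ p~q (~-sym a~p) (~-sym a~q) x∈ p≁x q≁x

      reduction : Reduction S L
      reduction with nonEdge⊎reduction
      ... | inj₂ r = r
      ... | inj₁ e with triangle?
      ...   | inj₁ T   = contradiction e (clique T)
      ...   | inj₂ no△ = TriangleFree.reduction no△ e

    -- Claw-free graphs

    module ClawFree (noClaw : NoClaw) where

      record Triad : Set where
        constructor triad
        field
          {a b c} : V
          a∈  : a ∈ S
          b∈  : b ∈ S
          c∈  : c ∈ S
          a≢b : a ≢ b
          a≢c : a ≢ c
          b≢c : b ≢ c
          a≁b : a ≁ b
          a≁c : a ≁ c
          b≁c : b ≁ c

      swap₂₃ rotate : Triad → Triad
      swap₂₃ (triad a∈ b∈ c∈ a≢b a≢c b≢c a≁b a≁c b≁c) =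
        triad a∈ c∈ b∈ a≢c a≢b (≢-sym b≢c) a≁c a≁b (≁-sym b≁c)
      rotate (triad a∈ b∈ c∈ a≢b a≢c b≢c a≁b a≁c b≁c) =
        triad b∈ c∈ a∈ b≢c (≢-sym a≢b) (≢-sym a≢c) b≁c (≁-sym a≁b) (≁-sym a≁c)

      swap₁₂ : Triad → Triad
      swap₁₂ T = swap₂₃ (rotate T)

      not-all-three : (T : Triad) → let open Triad T in ∀ {y} → y ~ a → y ~ b → y ≁ c
      not-all-three (triad _ _ _ a≢b a≢c b≢c a≁b a≁c b≁c) y~a y~b y~c =
        noClaw y~a y~b y~c a≢b a≢c b≢c a≁b a≁c b≁c

      -- A common neighbor x of a and b makes {x} ∪ N(c) a clique.
      module Capped (T : Triad) {x : V} (x∈ : x ∈ S)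
                    (x~a : x ~ Triad.a T) (x~b : x ~ Triad.b T) where
        open Triad T

        x≁c : x ≁ c
        x≁c = not-all-three T x~a x~b

        -- A neighbor of `c` that sees both `a` and `b` is the center of a claw; one that sees
        -- neither is adjacent to `x` by 2K₂-freeness and completes a claw at `x`.
        sides : ∀ {y} → y ∈ S → c ~ y → (y ~ a × b ≁ y) ⊎ (y ~ b × a ≁ y)
        sides {y} y∈ c~y with y ~? a | y ~? b
        ... | yes y~a | yes y~b = contradiction (~-sym c~y) (not-all-three T y~a y~b)
        ... | yes y~a | no y≁b = inj₁ (y~a , ≁-sym y≁b)
        ... | no y≁a | yes y~b = inj₂ (y~b , ≁-sym y≁a)
        ... | no y≁a | no y≁b = contradiction
                (joined (~-sym x~a) c~y a≁c (≁-sym y≁a) x≁c)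
                λ x~y → noClaw x~a x~b x~y a≢b (λ { refl → a≁c (~-sym c~y) })
                  (λ { refl → b≁c (~-sym c~y) }) a≁b (≁-sym y≁a) (≁-sym y≁b)

        complete : ∀ {y} → y ∈ S → c ~ y → x ~ y
        complete y∈ c~y with sides y∈ c~y
        ... | inj₁ (_ , b≁y) = joined (~-sym x~b) c~y b≁c b≁y x≁c
        ... | inj₂ (_ , a≁y) = joined (~-sym x~a) c~y a≁c a≁y x≁c

        across : ∀ {y z} → y ~ a → b ≁ y → z ~ b → a ≁ z → y ~ z
        across y~a b≁y z~b a≁z = joined (~-sym y~a) (~-sym z~b) a≁b a≁z (≁-sym b≁y)

        -- `c` has a neighbor `r` that `a` lacks. It lies on the side of `b` and sees the whole side
        -- of `a`, so nonadjacent `y` and `z` would form a claw at `r` together with `b`.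
        one-side : ∀ {y z} → c ~ y → c ~ z → y ~ a → b ≁ y → z ~ a → b ≁ z → y ≢ z → y ~ z
        one-side {y} {z} c~y c~z y~a b≁y z~a b≁z y≢z with r , r∈ , c~r , a≁r ← inc c∈ a∈ (≢-sym a≢c)
          with sides r∈ c~r
        ... | inj₁ (r~a , _) = contradiction (~-sym r~a) a≁r
        ... | inj₂ (r~b , _) = decidable-stable (y ~? z)
                (noClaw r~b (~-sym (across y~a b≁y r~b a≁r)) (~-sym (across z~a b≁z r~b a≁r))
                  (λ { refl → b≁c (~-sym c~y) }) (λ { refl → b≁c (~-sym c~z) }) y≢z b≁y b≁z)

      capped-reduction : (T : Triad) → let open Triad T in ∀ {x} → x ∈ S → x ~ a → x ~ b → Reduction S L
      capped-reduction T x∈ x~a x~b = clique-lowDegree c∈ x∈ (≁-sym x≁c) complete clique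
        where
        open Triad T
        open Capped T x∈ x~a x~b
        clique : ∀ {y z} → y ∈ S → z ∈ S → c ~ y → c ~ z → y ≢ z → y ~ z
        clique y∈ z∈ c~y c~z y≢z with sides y∈ c~y | sides z∈ c~z
        ... | inj₁ (y~a , b≁y) | inj₁ (z~a , b≁z) = one-side c~y c~z y~a b≁y z~a b≁z y≢z
        ... | inj₁ (y~a , b≁y) | inj₂ (z~b , a≁z) = across y~a b≁y z~b a≁z
        ... | inj₂ (y~b , a≁y) | inj₁ (z~a , b≁z) = ~-sym (across z~a b≁z y~b a≁y)
        ... | inj₂ (y~b , a≁y) | inj₂ (z~b , a≁z) =
                Capped.one-side (swap₁₂ T) x∈ x~b x~a c~y c~z y~b a≁y z~b a≁z y≢z

      Uncapped : V → V → Set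
      Uncapped u v = ∀ {x} → x ∈ S → ¬ (x ~ u × x ~ v)

      cap? : ∀ u v → (∃[ x ] x ∈ S × x ~ u × x ~ v) ⊎ Uncapped u v
      cap? u v = search (λ x → (x ~? u) ×-dec (x ~? v)) S

      uncapped-joined : ∀ {u v y z} → u ≁ v → Uncapped u v → y ∈ S → z ∈ S → u ~ y → v ~ z → y ~ z
      uncapped-joined u≁v unc y∈ z∈ u~y v~z = joined u~y v~z u≁v
        (λ u~z → unc z∈ (~-sym u~z , ~-sym v~z)) (λ y~v → unc y∈ (~-sym u~y , y~v))

      -- N(a), N(b), N(c) are disjoint and pairwise complete, and no color occurs three times in
      -- one of them. Hence N(a) ∪ N(b) has at most two vertices of each color and omits the
      -- color of some z ∈ N(c).
      uncapped-reduction : (T : Triad) → let open Triad T in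
        Uncapped a b → Uncapped a c → Uncapped b c → Reduction S L
      -- `c` has a neighbor, since otherwise its neighborhood would lie inside that of `a`.
      uncapped-reduction T ab ac bc = bound (inc c∈ a∈ (≢-sym a≢c))
        where
        open Triad T
        bound : ∃[ z ] z ∈ S × c ~ z × a ≁ z → Reduction S L
        bound (z , z∈ , c~z , _) = small
          where
          z? : Decidable (_≡ α z)
          z? = _≟ α z
          N : List V
          N = Nbrs a ++ Nbrs b
          N⁻ : ∀ {y} → y ∈ N → y ∈ S × (a ~ y ⊎ b ~ y)
          N⁻ y∈ with ∈-++⁻ (Nbrs a) y∈
          ... | inj₁ y∈a = let y∈S , a~y = ∈-Nbrs⁻ y∈a in y∈S , inj₁ a~y
          ... | inj₂ y∈b = let y∈S , b~y = ∈-Nbrs⁻ y∈b in y∈S , inj₂ b~y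
          uniqN : Unique N
          uniqN = Unique.++⁺ (Unique.filter⁺ (a ~?_) uniqS) (Unique.filter⁺ (b ~?_) uniqS)
            λ (y∈a , y∈b) → let y∈S , a~y = ∈-Nbrs⁻ y∈a in
              ab y∈S (~-sym a~y , ~-sym (proj₂ (∈-Nbrs⁻ y∈b)))
          color∈ : ∀ {y} → y ∈ N → α y ∈ K ∖ z?
          color∈ y∈ with N⁻ y∈
          ... | y∈S , inj₁ a~y = ∈-∖⁺ z? (α∈K y∈S)
                  (α-≢ y∈S z∈ (uncapped-joined a≁c ac y∈S z∈ a~y c~z))
          ... | y∈S , inj₂ b~y = ∈-∖⁺ z? (α∈K y∈S)
                  (α-≢ y∈S z∈ (uncapped-joined b≁c bc y∈S z∈ b~y c~z))
          same-side : ∀ {y w} → y ∈ N → w ∈ N → y ≁ w → (a ~ y × a ~ w) ⊎ (b ~ y × b ~ w)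
          same-side y∈ w∈ y≁w with N⁻ y∈ | N⁻ w∈
          ... | _ , inj₁ a~y | _ , inj₁ a~w = inj₁ (a~y , a~w)
          ... | _ , inj₂ b~y | _ , inj₂ b~w = inj₂ (b~y , b~w)
          ... | y∈S , inj₁ a~y | w∈S , inj₂ b~w =
                  contradiction (uncapped-joined a≁b ab y∈S w∈S a~y b~w) y≁w
          ... | y∈S , inj₂ b~y | w∈S , inj₁ a~w =
                  contradiction (~-sym (uncapped-joined a≁b ab w∈S y∈S a~w b~y)) y≁w
          no-three : ∀ {x y w} → x ∈ N → y ∈ N → w ∈ N → x ≁ y → x ≁ w → y ≁ w →
                     x ≢ y → x ≢ w → ¬ y ≢ w
          -- Nonadjacent vertices of `N` lie on the same side, so three of them form a claw at `a`
          -- or at `b`.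
          no-three x∈ y∈ w∈ x≁y x≁w y≁w x≢y x≢w y≢w with same-side x∈ y∈ x≁y | same-side x∈ w∈ x≁w
          ... | inj₁ (a~x , a~y) | inj₁ (_ , a~w) = noClaw a~x a~y a~w x≢y x≢w y≢w x≁y x≁w y≁w
          ... | inj₂ (b~x , b~y) | inj₂ (_ , b~w) = noClaw b~x b~y b~w x≢y x≢w y≢w x≁y x≁w y≁w
          ... | inj₁ (a~x , _) | inj₂ (b~x , _) = ab (proj₁ (N⁻ x∈)) (~-sym a~x , ~-sym b~x)
          ... | inj₂ (b~x , _) | inj₁ (a~x , _) = ab (proj₁ (N⁻ x∈)) (~-sym a~x , ~-sym b~x)
          total : length (Nbrs a) + length (Nbrs b) ≤ length (K ∖ z?) * 2
          total = subst (_≤ length (K ∖ z?) * 2) (length-++ (Nbrs a)) (length-≤-by-fibres _≟_ α (K ∖ z?) uniqN color∈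
            λ u zs⊆N same → length≤2 u λ x∈ y∈ w∈ →
              let ≁ : ∀ {y w} → y ∈ _ → w ∈ _ → y ≁ w
                  ≁ y∈ w∈ y~w = α-≢ (proj₁ (N⁻ (zs⊆N y∈))) (proj₁ (N⁻ (zs⊆N w∈))) y~w
                                  (trans (same y∈) (sym (same w∈)))
              in no-three (zs⊆N x∈) (zs⊆N y∈) (zs⊆N w∈) (≁ x∈ y∈) (≁ x∈ w∈) (≁ y∈ w∈))
          K∖z<K : length (K ∖ z?) < length K
          K∖z<K = ∖-length-< z? (α∈K z∈) refl
          low : ∀ {u} → u ∈ S → length (Nbrs u) ≤ length (K ∖ z?) → Reduction S L
          low u∈ ≤K = lowDegree u∈ (≤-trans (s≤s (≤-trans (s≤s ≤K) K∖z<K)) K<L)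
          small : Reduction S L
          -- By `total` one of the two degrees is at most the length of `K ∖ z?`, which is at least
          -- two below that of `L`: both `spare t` and `α z` are gone.
          small with length (Nbrs a) ≤? length (K ∖ z?) | length (Nbrs b) ≤? length (K ∖ z?)
          ... | yes a≤ | _ = low a∈ a≤
          ... | no _ | yes b≤ = low b∈ b≤
          ... | no a≰ | no b≰ = contradiction
                  (subst (length (Nbrs a) + length (Nbrs b) ≤_) (trans (*-comm (length (K ∖ z?)) 2)
                    (cong (length (K ∖ z?) +_) (+-identityʳ _))) total)
                  (<⇒≱ (+-mono-< (≰⇒> a≰) (≰⇒> b≰)))

      triad? : Triad ⊎ ¬ Triad
      triad? with search (λ a → Any.any? (λ b → Any.any? (λ c →
                    ¬? (a ≟ b) ×-dec ¬? (a ≟ c) ×-dec ¬? (b ≟ c) ×-dec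
                    ¬? (a ~? b) ×-dec ¬? (a ~? c) ×-dec ¬? (b ~? c)) S) S) S
      ... | inj₁ (a , a∈ , found) =
              let b , b∈ , found′ = find found
                  c , c∈ , a≢b , a≢c , b≢c , a≁b , a≁c , b≁c = find found′
              in inj₁ (triad a∈ b∈ c∈ a≢b a≢c b≢c a≁b a≁c b≁c)
      ... | inj₂ none = inj₂ λ { (triad a∈ b∈ c∈ a≢b a≢c b≢c a≁b a≁c b≁c) →
              none a∈ (lose b∈ (lose c∈ (a≢b , a≢c , b≢c , a≁b , a≁c , b≁c))) }

      -- |S| ≤ 2 |K| < 2 |L|, so every coloring has a color class with at most one vertex.
      triadFree-absorbed : ¬ Triad → ∀ {f} → Proper S L f → Absorbed S L f
      triadFree-absorbed noTriad {f} pf with b , b∈ , thin ← small-fibre _≟_ f uniqL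
        (≤-<-trans (length-≤-by-fibres _≟_ α K uniqS α∈K λ u zs⊆S same → length≤2 u
            λ x∈ y∈ w∈ x≢y x≢w y≢w →
              let ≁ : ∀ {y w} → y ∈ _ → w ∈ _ → y ≁ w
                  ≁ y∈ w∈ y~w = α-≢ (zs⊆S y∈) (zs⊆S w∈) y~w (trans (same y∈) (sym (same w∈)))
              in noTriad (triad (zs⊆S x∈) (zs⊆S y∈) (zs⊆S w∈) x≢y x≢w y≢w
                                (≁ x∈ y∈) (≁ x∈ w∈) (≁ y∈ w∈)))
          (*-monoˡ-< 2 K<L))
        with search (λ v → f v ≟ b) S
      ... | inj₁ (v , v∈ , fv≡b) = record
              { color∈ = b∈ ; target = t ; rep∈ = v∈
              ; contained = λ w∈ fw≡b → cong α (thin w∈ v∈ fw≡b fv≡b) }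
      -- The class is empty and fits into any class; that of `v₀` is taken.
      ... | inj₂ unused = record
              { color∈ = b∈ ; target = t ; rep∈ = v₀∈
              ; contained = λ w∈ fw≡b → contradiction fw≡b (unused w∈) }

      reduction : Reduction S L
      reduction with triad?
      ... | inj₂ noTriad = absorbed (triadFree-absorbed noTriad)
      ... | inj₁ T with cap? (Triad.a T) (Triad.b T)
      ...   | inj₁ (x , x∈ , x~a , x~b) = capped-reduction T x∈ x~a x~b
      ...   | inj₂ ab with cap? (Triad.a T) (Triad.c T)
      ...     | inj₁ (x , x∈ , x~a , x~c) = capped-reduction (swap₂₃ T) x∈ x~a x~c
      ...     | inj₂ ac with cap? (Triad.b T) (Triad.c T)
      ...       | inj₁ (x , x∈ , x~b , x~c) = capped-reduction (rotate T) x∈ x~b x~c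
      ...       | inj₂ bc = uncapped-reduction T ab ac bc

    -- Diamond-free graphs

    module DiamondFree (noDiamond : NoDiamond) where

      rotate swap₂₃ : Triangle → Triangle
      rotate (△ x∈ y∈ z∈ x~y x~z y~z) = △ y∈ z∈ x∈ y~z (~-sym x~y) (~-sym x~z)
      swap₂₃ (△ x∈ y∈ z∈ x~y x~z y~z) = △ x∈ z∈ y∈ x~z x~y (~-sym y~z)

      Only : Triangle → Pred V 0ℓ
      Only T v = x ~ v × y ≁ v × z ≁ v
        where open Triangle T

      Apex : Triangle → Pred V 0ℓ
      Apex T v = x ~ v × y ~ v × z ~ v
        where open Triangle T

      data Kind (T : Triangle) (v : V) : Set where
        corner₁ : v ≡ Triangle.x T → Kind T v
        corner₂ : v ≡ Triangle.y T → Kind T v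
        corner₃ : v ≡ Triangle.z T → Kind T v
        only₁   : Only T v → Kind T v
        only₂   : Only (rotate T) v → Kind T v
        only₃   : Only (rotate (rotate T)) v → Kind T v
        apex    : Apex T v → Kind T v

      two⇒three : (T : Triangle) → let open Triangle T in ∀ {v} → x ~ v → y ~ v → v ≢ z → z ~ v
      two⇒three (△ {z = z} _ _ _ x~y x~z y~z) {v} x~v y~v v≢z = decidable-stable (z ~? v)
        (noDiamond x~y x~z x~v y~z y~v (≢-sym v≢z))

      -- An edge between two such vertices would form a 2K₂ with the edge `y z`.
      only-independent : (T : Triangle) → Independent S (Only T)
      only-independent (△ _ _ _ _ _ y~z) _ _ (_ , y≁u , z≁u) (_ , y≁v , z≁v) u~v =
        no2K₂ u~v y~z (≁-sym y≁u) (≁-sym z≁u) (≁-sym y≁v) (≁-sym z≁v)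

      -- Take a neighbor of `u` that `y` lacks. Against the edge `y z` it must see `z`, and seeing
      -- `x` as well would force it to see `y`.
      next : (T : Triangle) → ∀ {u} → u ∈ S → Only T u →
             ∃[ w ] w ∈ S × Only (rotate (rotate T)) w × u ~ w
      next T@(△ {x} {y} {z} x∈ y∈ z∈ x~y x~z y~z) {u} u∈ (x~u , y≁u , z≁u)
        with w , w∈ , u~w , y≁w ← inc u∈ y∈ (λ { refl → z≁u (~-sym y~z) })
        = w , w∈ , (z~w , x≁w , y≁w) , u~w
        where
        z~w : z ~ w
        z~w = decidable-stable (z ~? w) λ z≁w →
          no2K₂ u~w y~z (≁-sym y≁u) (≁-sym z≁u) (≁-sym y≁w) (≁-sym z≁w)
        x≁w : x ≁ w
        x≁w x~w = y≁w (two⇒three (swap₂₃ T) x~w z~w λ { refl → y≁u (~-sym u~w) })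

      -- A neighbor of `v` that `x` lacks would see both `y` and `z` by 2K₂-freeness, and therefore
      -- `x` too.
      attached : (T : Triangle) → let open Triangle T in ∀ {v} → v ∈ S → v ≢ x →
                 x ≁ v → y ≁ v → z ≁ v → ⊥
      attached T@(△ x∈ y∈ z∈ x~y x~z y~z) v∈ v≢x x≁v y≁v z≁v
        with u , u∈ , v~u , x≁u ← inc v∈ x∈ v≢x =
        x≁u (two⇒three (rotate T)
          (~-sym (joined v~u x~y (≁-sym x≁v) (≁-sym y≁v) (≁-sym x≁u)))
          (~-sym (joined v~u x~z (≁-sym x≁v) (≁-sym z≁v) (≁-sym x≁u)))
          λ { refl → x≁v (~-sym v~u) })

      kind : (T : Triangle) → ∀ {v} → v ∈ S → Kind T v
      kind T@(△ {x} {y} {z} x∈ y∈ z∈ x~y x~z y~z) {v} v∈ with v ≟ x | v ≟ y | v ≟ z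
      ... | yes v≡x | _ | _ = corner₁ v≡x
      ... | no _ | yes v≡y | _ = corner₂ v≡y
      ... | no _ | no _ | yes v≡z = corner₃ v≡z
      ... | no v≢x | no v≢y | no v≢z with x ~? v | y ~? v | z ~? v
      ...   | yes x~v | yes y~v | _      = apex (x~v , y~v , two⇒three T x~v y~v v≢z)
      ...   | yes x~v | no y≁v | yes z~v =
                contradiction (two⇒three (swap₂₃ T) x~v z~v v≢y) y≁v
      ...   | no x≁v | yes y~v | yes z~v =
                contradiction (two⇒three (rotate T) y~v z~v v≢x) x≁v
      ...   | yes x~v | no y≁v | no z≁v  = only₁ (x~v , y≁v , z≁v)
      ...   | no x≁v | yes y~v | no z≁v  = only₂ (y~v , z≁v , x≁v)
      ...   | no x≁v | no y≁v | yes z~v  = only₃ (z~v , x≁v , y≁v)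
      ...   | no x≁v | no y≁v | no z≁v   = contradiction z≁v (attached T v∈ v≢x x≁v y≁v)

      -- Let `u` be the neighbor of `v` attached to `z`. The edges `v u` and `y w` form a 2K₂,
      -- because `w` seeing `v` or `u` would give a diamond on `x w` or on `z w`.
      apex-excludes-only : (T : Triangle) → ∀ {w} → w ∈ S → Apex T w → ∀ {v} → v ∈ S → ¬ Only T v
      apex-excludes-only T@(△ {x} {y} {z} _ _ _ x~y x~z y~z) {w} w∈ (x~w , y~w , z~w)
        v∈ only@(x~v , y≁v , z≁v)
        with u , u∈ , (z~u , x≁u , y≁u) , v~u ← next T v∈ only =
        no2K₂ v~u y~w (≁-sym y≁v)
          (λ v~w → noDiamond x~w x~y x~v (~-sym y~w) (~-sym v~w) (λ { refl → z≁v (~-sym y~z) }) y≁v)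
          (≁-sym y≁u)
          (λ u~w → noDiamond z~w (~-sym y~z) z~u (~-sym y~w) (~-sym u~w)
                     (λ { refl → x≁u x~y }) y≁u)

      full : (T : Triangle) → let open Triangle T in ∀ {w} → w ∈ S → Apex T w → ∀ {v} → v ∈ S →
             (v ≡ x ⊎ x ~ v) × (v ≡ y ⊎ y ~ v)
      full T@(△ _ _ _ x~y x~z y~z) w∈ ap@(x~w , y~w , z~w) v∈ with kind T v∈
      ... | corner₁ v≡x = inj₁ v≡x , inj₂ (subst (_ ~_) (sym v≡x) (~-sym x~y))
      ... | corner₂ v≡y = inj₂ (subst (_ ~_) (sym v≡y) x~y) , inj₁ v≡y
      ... | corner₃ v≡z = inj₂ (subst (_ ~_) (sym v≡z) x~z) , inj₂ (subst (_ ~_) (sym v≡z) y~z)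
      ... | only₁ o = contradiction o (apex-excludes-only T w∈ ap v∈)
      ... | only₂ o = contradiction o (apex-excludes-only (rotate T) w∈ (y~w , z~w , x~w) v∈)
      ... | only₃ o = contradiction o (apex-excludes-only (rotate (rotate T)) w∈ (z~w , x~w , y~w) v∈)
      ... | apex (x~v , y~v , _) = inj₂ x~v , inj₂ y~v

      NoApex : Triangle → Set
      NoApex T = ∀ {v} → v ∈ S → ¬ Apex T v

      -- With an apex, `full` makes every vertex equal or adjacent to both `x` and `y`, so a
      -- non-edge would complete a diamond on the edge `x y`.
      apex-clique : (T : Triangle) → NonEdge → NoApex T
      apex-clique T@(△ _ _ _ x~y _ _) (a , b , a∈ , b∈ , a≢b , a≁b) w∈ ap
        with full T w∈ ap a∈ | full T w∈ ap b∈
      ... | inj₁ refl , _ | inj₁ refl , _ = a≢b refl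
      ... | inj₁ refl , _ | inj₂ a~b , _ = a≁b a~b
      ... | inj₂ b~a , _ | inj₁ refl , _ = a≁b (~-sym b~a)
      ... | _ , inj₁ refl | _ , inj₁ refl = a≢b refl
      ... | _ , inj₁ refl | _ , inj₂ a~b = a≁b a~b
      ... | _ , inj₂ b~a | _ , inj₁ refl = a≁b (~-sym b~a)
      ... | inj₂ x~a , inj₂ y~a | inj₂ x~b , inj₂ y~b = noDiamond x~y x~a x~b y~a y~b a≢b a≁b

      -- Compares vertices attached to `x`, in order to show that there are at most two: any two
      -- distinct ones are comparable, but no chain has three.
      Steeper : Triangle → V → V → Set
      Steeper T v w =
        (∃[ p ] p ∈ S × Only (rotate T) p × v ~ p × w ≁ p) ×
        (∃[ r ] r ∈ S × Only (rotate (rotate T)) r × w ~ r × v ≁ r)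

      -- The private neighbors `p` and `q` from `crossing` are attached to `y` or to `z`; being
      -- adjacent, they are not attached to the same corner.
      steeper-total : (T : Triangle) → NoApex T → ∀ {v w} → v ∈ S → w ∈ S → Only T v → Only T w →
                      v ≢ w → Steeper T v w ⊎ Steeper T w v
      steeper-total T noApex {v} {w} v∈ w∈ ov ow v≢w
        with p , q , p∈ , q∈ , v~p , w≁p , w~q , v≁q , p~q ←
               crossing v∈ w∈ v≢w (only-independent T v∈ w∈ ov ow) =
        compare (side v∈ p∈ ov ow v~p w≁p) (side w∈ q∈ ow ov w~q v≁q)
        where
        side : ∀ {v w p} → v ∈ S → p ∈ S → Only T v → Only T w → v ~ p → w ≁ p →
               Only (rotate T) p ⊎ Only (rotate (rotate T)) p
        side v∈ p∈ ov@(_ , y≁v , z≁v) (x~w , _) v~p w≁p with kind T p∈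
        ... | corner₁ refl = contradiction (~-sym x~w) w≁p
        ... | corner₂ refl = contradiction (~-sym v~p) y≁v
        ... | corner₃ refl = contradiction (~-sym v~p) z≁v
        ... | only₁ op = contradiction v~p (only-independent T v∈ p∈ ov op)
        ... | only₂ op = inj₁ op
        ... | only₃ op = inj₂ op
        ... | apex ap = contradiction ap (noApex p∈)
        compare : Only (rotate T) p ⊎ Only (rotate (rotate T)) p →
                  Only (rotate T) q ⊎ Only (rotate (rotate T)) q →
                  Steeper T v w ⊎ Steeper T w v
        compare (inj₁ op) (inj₂ oq) = inj₁ ((p , p∈ , op , v~p , w≁p) , (q , q∈ , oq , w~q , v≁q))
        compare (inj₂ op) (inj₁ oq) = inj₂ ((q , q∈ , oq , w~q , v≁q) , (p , p∈ , op , v~p , w≁p))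
        compare (inj₁ op) (inj₁ oq) = contradiction p~q (only-independent (rotate T) p∈ q∈ op oq)
        compare (inj₂ op) (inj₂ oq) =
          contradiction p~q (only-independent (rotate (rotate T)) p∈ q∈ op oq)

      -- By 2K₂-freeness, what `w`, `v`, `u` see among the vertices attached to `y` increases in
      -- this order. So `u` and `v` both see `q` and `s`; `r` sees both as well, and the edge `v r`
      -- with `q` and `s` is a diamond.
      ¬steeper-chain : (T : Triangle) → ∀ {u v w} → u ∈ S → v ∈ S → w ∈ S →
        Only T u → Only T v → Only T w → Steeper T u v → ¬ Steeper T v w
      ¬steeper-chain T@(△ {z = z} _ _ _ _ _ _) {u} {v} {w} u∈ v∈ w∈
        ou@(_ , _ , z≁u) ov ow@(x~w , y≁w , z≁w)
        ((p , p∈ , op , u~p , v≁p) , (r , r∈ , (z~r , _) , v~r , u≁r))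
        ((q , q∈ , oq , v~q , w≁q) , _)
        -- Exchanging `y` and `z` makes `next` yield a neighbor of `w` that is attached to `y`.
        with s , s∈ , (y~s , x≁s , z≁s) , w~s ← next (swap₂₃ T) w∈ (x~w , z≁w , y≁w) =
        noDiamond v~r v~s v~q (r~ os u~s) (r~ oq u~q) (λ { refl → w≁q w~s })
          (only-independent (rotate T) s∈ q∈ os oq)
        where
        os : Only (rotate T) s
        os = y~s , z≁s , x≁s
        nested : ∀ {a b c d} → a ∈ S → b ∈ S → c ∈ S → d ∈ S → Only T a → Only T b →
          Only (rotate T) c → Only (rotate T) d → a ~ c → b ≁ c → b ~ d → a ~ d
        nested a∈ b∈ c∈ d∈ oa ob oc od a~c b≁c b~d =
          joined (~-sym a~c) b~d (≁-sym b≁c) (only-independent (rotate T) c∈ d∈ oc od)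
            (only-independent T a∈ b∈ oa ob)
        v~s : v ~ s
        v~s = nested v∈ w∈ q∈ s∈ ov ow oq os v~q w≁q w~s
        u~s : u ~ s
        u~s = nested u∈ v∈ p∈ s∈ ou ov op os u~p v≁p v~s
        u~q : u ~ q
        u~q = nested u∈ v∈ p∈ q∈ ou ov op oq u~p v≁p v~q
        r~ : ∀ {c} → Only (rotate T) c → u ~ c → r ~ c
        r~ (_ , z≁c , _) u~c = ~-sym (joined u~c z~r (≁-sym z≁u) u≁r (≁-sym z≁c))

      -- `steeper-total` orients each pair among three vertices, and every such orientation contains
      -- a chain that `¬steeper-chain` forbids.
      only-≤2 : (T : Triangle) → NoApex T → ∀ {u v w} → u ∈ S → v ∈ S → w ∈ S →
        Only T u → Only T v → Only T w → u ≢ v → u ≢ w → ¬ v ≢ w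
      only-≤2 T noApex u∈ v∈ w∈ ou ov ow u≢v u≢w v≢w
        with steeper-total T noApex u∈ v∈ ou ov u≢v | steeper-total T noApex v∈ w∈ ov ow v≢w
           | steeper-total T noApex u∈ w∈ ou ow u≢w
      ... | inj₁ uv | inj₁ vw | _       = ¬steeper-chain T u∈ v∈ w∈ ou ov ow uv vw
      ... | inj₂ vu | inj₂ wv | _       = ¬steeper-chain T w∈ v∈ u∈ ow ov ou wv vu
      ... | inj₁ uv | inj₂ wv | inj₁ uw = ¬steeper-chain T u∈ w∈ v∈ ou ow ov uw wv
      ... | inj₁ uv | inj₂ wv | inj₂ wu = ¬steeper-chain T w∈ u∈ v∈ ow ou ov wu uv
      ... | inj₂ vu | inj₁ vw | inj₁ uw = ¬steeper-chain T v∈ u∈ w∈ ov ou ow vu uw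
      ... | inj₂ vu | inj₁ vw | inj₂ wu = ¬steeper-chain T v∈ w∈ u∈ ov ow ou vw wu

      -- A corner is grouped with the vertices attached to the next corner; without an apex the
      -- three rotations are independent sets covering `S`.
      Part : Triangle → Pred V 0ℓ
      Part T v = v ≡ Triangle.x T ⊎ Only (rotate T) v

      part? : (T : Triangle) → Decidable (Part T)
      part? T v = (v ≟ x) ⊎-dec ((y ~? v) ×-dec ¬? (z ~? v) ×-dec ¬? (x ~? v))
        where open Triangle T

      part-independent : (T : Triangle) → Independent S (Part T)
      part-independent T _ _ (inj₁ refl) (inj₁ refl) = ~-irr refl
      part-independent T _ _ (inj₁ refl) (inj₂ (_ , _ , x≁v)) = x≁v
      part-independent T _ _ (inj₂ (_ , _ , x≁u)) (inj₁ refl) = ≁-sym x≁u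
      part-independent T u∈ v∈ (inj₂ ou) (inj₂ ov) = only-independent (rotate T) u∈ v∈ ou ov

      parts-cover : (T : Triangle) → NoApex T → ∀ {v} → v ∈ S →
        ¬ Part T v → ¬ Part (rotate T) v → Part (rotate (rotate T)) v
      parts-cover T noApex v∈ ¬p₁ ¬p₂ with kind T v∈
      ... | corner₁ v≡x = contradiction (inj₁ v≡x) ¬p₁
      ... | corner₂ v≡y = contradiction (inj₁ v≡y) ¬p₂
      ... | corner₃ v≡z = inj₁ v≡z
      ... | only₁ o = inj₂ o
      ... | only₂ o = contradiction (inj₂ o) ¬p₁
      ... | only₃ o = contradiction (inj₂ o) ¬p₂
      ... | apex ap = contradiction ap (noApex v∈)

      module ThreeParts (T : Triangle) (noApex : NoApex T) where
        open Triangle T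

        outer parts : V → C
        outer = paint (part? (rotate T)) (α y) (λ _ → α z)
        parts = paint (part? T) (α x) outer

        paint-all : ∀ {P : Pred V 0ℓ} (P? : Decidable P) {b f} (Q : Pred C 0ℓ) → Q b →
                    (∀ v → Q (f v)) → ∀ v → Q (paint P? b f v)
        paint-all P? Q qb qf v with P? v
        ... | yes _ = qb
        ... | no _  = qf v

        partition : Target S L
        partition = record
          { col = parts
          ; proper = paint-proper (part? T) (inPalette (proper t) x∈) (part-independent T)
              (paint-proper (part? (rotate T)) (inPalette (proper t) y∈)
                (λ u∈ v∈ → part-independent (rotate T) (⊆S u∈) (⊆S v∈))
                (record { inPalette = λ _ → inPalette (proper t) z∈
                        ; separates = λ u∈ v∈ u~v _ → part-independent (rotate (rotate T))
                            (⊆S (⊆S₁ u∈)) (⊆S (⊆S₁ v∈)) (rest u∈) (rest v∈) u~v })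
                λ _ _ _ _ _ → α-≢ y∈ z∈ y~z ∘ sym)
              λ {_} {v} _ _ _ _ _ → paint-all (part? (rotate T)) (_≢ α x) (α-≢ x∈ y∈ x~y ∘ sym)
                (λ _ → α-≢ x∈ z∈ x~z ∘ sym) v
          ; spare = spare t
          ; spare∈ = spare∈ t
          ; misses = λ {v} _ → paint-all (part? T) (_≢ spare t) (misses t x∈)
              (paint-all (part? (rotate T)) (_≢ spare t) (misses t y∈) (λ _ → misses t z∈)) v
          }
          where
          S₁ : List V
          S₁ = S ∖ part? T
          ⊆S : ∀ {v} → v ∈ S₁ → v ∈ S
          ⊆S = proj₁ ∘ ∈-∖⁻ (part? T) S
          ⊆S₁ : ∀ {v} → v ∈ S₁ ∖ part? (rotate T) → v ∈ S₁
          ⊆S₁ = proj₁ ∘ ∈-∖⁻ (part? (rotate T)) S₁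
          rest : ∀ {v} → v ∈ S₁ ∖ part? (rotate T) → Part (rotate (rotate T)) v
          rest v∈ = let v∈S₁ , ¬p₂ = ∈-∖⁻ (part? (rotate T)) S₁ v∈
                        v∈S  , ¬p₁ = ∈-∖⁻ (part? T) S v∈S₁
                    in parts-cover T noApex v∈S ¬p₁ ¬p₂

        absorbed-in-part : ∀ {f b} → b ∈ L → (∀ {v} → v ∈ S → f v ≡ b → Part T v) → Absorbed S L f
        absorbed-in-part b∈ class⊆part = record
          { color∈ = b∈ ; target = partition ; rep∈ = x∈
          ; contained = λ v∈ fv≡b → trans (paint-in (part? T) outer (class⊆part v∈ fv≡b))
                                          (sym (paint-in (part? T) outer (inj₁ refl)))
          }

      -- A vertex with the color of `x` is not adjacent to `x`, so it is `x` itself or attached to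
      -- `y` or to `z`. Only in the last case does it leave the `Part`.
      corner-class : (T : Triangle) → let open Triangle T in NoApex T → ∀ {f} → Proper S L f →
        Absorbed S L f ⊎ (∃[ v ] v ∈ S × Only (rotate (rotate T)) v × f v ≡ f x)
      corner-class T@(△ {x} {y} {z} x∈ y∈ z∈ x~y x~z y~z) noApex {f} pf
        with search (λ v → (f v ≟ f x) ×-dec ¬? (part? T v)) S
      ... | inj₂ inside = inj₁ (ThreeParts.absorbed-in-part T noApex (inPalette pf x∈)
              λ {v} v∈ same → decidable-stable (part? T v) λ ¬p → inside v∈ (same , ¬p))
      ... | inj₁ (v , v∈ , same , ¬p) with kind T v∈
      ...   | corner₁ v≡x = contradiction (inj₁ v≡x) ¬p
      ...   | corner₂ refl = contradiction (sym same) (separates pf x∈ y∈ x~y)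
      ...   | corner₃ refl = contradiction (sym same) (separates pf x∈ z∈ x~z)
      ...   | only₁ (x~v , _) = contradiction (sym same) (separates pf x∈ v∈ x~v)
      ...   | only₂ o = contradiction (inj₂ o) ¬p
      ...   | only₃ o = inj₂ (v , v∈ , o , same)
      ...   | apex ap = contradiction ap (noApex v∈)

      -- If the classes of `y` and `z` both escape, they contain vertices attached to `x`. With `w`
      -- these are three vertices of different colors there, against `only-≤2`.
      absorbed-at : (T : Triangle) → let open Triangle T in NoApex T → ∀ {f} → Proper S L f →
        ∀ {w} → w ∈ S → Only T w → f w ≢ f y → f w ≢ f z → Absorbed S L f
      absorbed-at T@(△ _ y∈ z∈ _ _ y~z) noApex {f} pf w∈ ow ≢y ≢z
        with corner-class (rotate T) (λ v∈ (y~v , z~v , x~v) → noApex v∈ (x~v , y~v , z~v)) pf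
           -- The opposite orientation pairs `z` with the vertices attached to `y`, so a vertex
           -- escaping from the class of `z` is also attached to `x`.
           | corner-class (rotate (swap₂₃ T))
               (λ v∈ (z~v , y~v , x~v) → noApex v∈ (x~v , y~v , z~v)) pf
      ... | inj₁ done | _ = done
      ... | inj₂ _ | inj₁ done = done
      ... | inj₂ (u , u∈ , ou , fu≡fy) | inj₂ (v , v∈ , (x~v , z≁v , y≁v) , fv≡fz) =
        contradiction (λ { refl → ≢z fv≡fz })
          (only-≤2 T noApex u∈ v∈ w∈ ou (x~v , y≁v , z≁v) ow
            (λ { refl → separates pf y∈ z∈ y~z (trans (sym fu≡fy) fv≡fz) })
            λ { refl → ≢y fu≡fy })

      -- Unless the class of some corner lies inside a Part, the three classes of the corners use
      -- up all vertices outside the triangle by only-≤2, so any fourth color is unused.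
      absorb : (T : Triangle) → NoApex T → ∀ {f} → Proper S L f → Absorbed S L f
      absorb T@(△ {x} {y} {z} x∈ y∈ z∈ x~y x~z y~z) noApex {f} pf
        with b , b∈ , b∉ ← fresh _≟_ {xs = f x ∷ f y ∷ f z ∷ []} uniqL
               (four-colors x∈ y∈ z∈ (α-≢ x∈ y∈ x~y) (α-≢ x∈ z∈ x~z) (α-≢ y∈ z∈ y~z))
        with search (λ v → f v ≟ b) S
      ... | inj₂ unused = ThreeParts.absorbed-in-part T noApex b∈
              λ v∈ fv≡b → contradiction fv≡b (unused v∈)
      ... | inj₁ (w , w∈ , refl) = outside (kind T w∈)
        where
        ≢x : f w ≢ f x
        ≢x = b∉ ∘ here
        ≢y : f w ≢ f y
        ≢y = b∉ ∘ there ∘ here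
        ≢z : f w ≢ f z
        ≢z = b∉ ∘ there ∘ there ∘ here
        outside : Kind T w → Absorbed S L f
        outside (corner₁ refl) = contradiction refl ≢x
        outside (corner₂ refl) = contradiction refl ≢y
        outside (corner₃ refl) = contradiction refl ≢z
        outside (only₁ o) = absorbed-at T noApex pf w∈ o ≢y ≢z
        outside (only₂ o) = absorbed-at (rotate T)
          (λ v∈ (y~v , z~v , x~v) → noApex v∈ (x~v , y~v , z~v)) pf w∈ o ≢z ≢x
        outside (only₃ o) = absorbed-at (rotate (rotate T))
          (λ v∈ (z~v , x~v , y~v) → noApex v∈ (x~v , y~v , z~v)) pf w∈ o ≢x ≢y
        outside (apex ap) = contradiction ap (noApex w∈)

      reduction : Reduction S L
      reduction with nonEdge⊎reduction
      ... | inj₂ r = r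
      ... | inj₁ e with triangle?
      ...   | inj₁ T   = absorbed (absorb T (apex-clique T e))
      ...   | inj₂ no△ = TriangleFree.reduction no△ e

-- Translation to colorings as vectors

module Translation (G : Graph) (ℓ : ℕ) where
  open Recoloring G ℓ

  Vs : List V
  Vs = allFin (order G)

  Cs : List C
  Cs = allFin ℓ

  at-proper : (c : Coloring G ℓ) → Proper Vs Cs (c at_)
  at-proper c = record { inPalette = λ _ → ∈-allFin _ ; separates = λ {u} {v} _ _ → isColoring c u v }

  fromProper : ∀ {f} → Proper Vs Cs f → Coloring G ℓ
  fromProper {f} pf = coloring (tabulate f) λ u v u~v eq → separates pf (∈-allFin u) (∈-allFin v) u~v
    (trans (sym (lookup∘tabulate f u)) (trans eq (lookup∘tabulate f v)))

  colors-injective : {c d : Coloring G ℓ} → colors c ≡ colors d → c ≡ d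
  colors-injective {coloring _ _} {coloring _ _} refl = refl

  at-injective : {c d : Coloring G ℓ} → (∀ v → c at v ≡ d at v) → c ≡ d
  at-injective {c} {d} eq = colors-injective (trans (sym (tabulate∘lookup (colors c)))
    (trans (tabulate-cong eq) (tabulate∘lookup (colors d))))

  -- `R` asks for exactly one differing vertex; if there is none, the colorings are equal and the
  -- empty path serves.
  oneChange⇒R : {c d : Coloring G ℓ} → OneChange Vs (c at_) (d at_) → Star (R G ℓ) c d
  oneChange⇒R {c} {d} one with Fin.any? (λ v → ¬? (c at v ≟ d at v))
  ... | yes (v , v≢) = (v , v≢ , λ w≢ → one (∈-allFin v) (∈-allFin _) v≢ w≢) ◅ ε
  ... | no same = subst (Star (R G ℓ) c)
          (at-injective λ v → decidable-stable (c at v ≟ d at v) λ v≢ → same (v , v≢)) ε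

  -- The ends are matched pointwise, since tabulating a function returns it only pointwise.
  reach⇒R : ∀ {f g} (c d : Coloring G ℓ) → (∀ v → c at v ≡ f v) → (∀ v → d at v ≡ g v) →
            Reach Vs Cs f g → Star (R G ℓ) c d
  reach⇒R c d c≡f d≡f ε = oneChange⇒R λ {u} _ _ u≢ _ → contradiction (trans (c≡f u) (sym (d≡f u))) u≢
  reach⇒R {f} c d c≡f d≡g (_◅_ {j = h} (ph , one) rest) =
    oneChange⇒R (λ {u} {v} u∈ v∈ u≢ v≢ → one u∈ v∈ (moved u≢) (moved v≢))
    ◅◅ reach⇒R e d e≡h d≡g rest
    where
    e : Coloring G ℓ
    e = fromProper ph
    e≡h : ∀ v → e at v ≡ h v
    e≡h = lookup∘tabulate h
    moved : ∀ {v} → c at v ≢ e at v → f v ≢ h v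
    moved {v} v≢ eq = v≢ (trans (c≡f v) (trans eq (sym (e≡h v))))

  target : ∀ {k} → Coloring G k → k < ℓ → Target Vs Cs
  target {k} c k<ℓ = record
    { col    = λ v → inject≤ (c at v) (<⇒≤ k<ℓ)
    ; proper = record
        { inPalette = λ _ → ∈-allFin _
        ; separates = λ {u} {v} _ _ u~v eq → isColoring c u v u~v (Fin.inject≤-injective _ _ _ _ eq)
        }
    -- The color numbered `k` is the first one beyond the image of `inject≤`.
    ; spare  = fromℕ< k<ℓ
    ; spare∈ = ∈-allFin _
    ; misses = λ {v} _ eq → <⇒≢ (Fin.toℕ<n (c at v))
        (trans (sym (Fin.toℕ-inject≤ _ _)) (trans (cong toℕ eq) (Fin.toℕ-fromℕ< k<ℓ)))
    }

-- Recolorability from reductions, and the four choices of `H`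

recolorable : ∀ {G} →
  (∀ {ℓ} → let open Recoloring G ℓ in
    ∀ {S L} → Unique S → Unique L → ∀ {v} → v ∈ S → Target S L → Reduction S L) →
  Recolorable G
recolorable {G} reduce ℓ ℓ≥ c d = reach⇒R c d (λ _ → refl) (λ _ → refl)
  (reducible-conn reduce (suc (length Vs)) ≤-refl (Unique.allFin⁺ (order G)) (Unique.allFin⁺ ℓ)
    (target (proj₁ (χ-isChromaticNumber G)) (subst (_≤ ℓ) (+-comm (χ G) 1) ℓ≥))
    (at-proper c) (at-proper d))
  where
  open Recoloring G ℓ
  open Translation G ℓ

theorem2 : ∀ H → H ∈ triangle ∷ paw ∷ claw ∷ diamond ∷ [] →
           ∀ G → ((2K₂ ∷ H ∷ []) -Free) G → Recolorable G
theorem2 H H∈ G (free₂ ∷ freeᴴ ∷ []) = recolorable reduce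
  where
  reduce : ∀ {ℓ} → let open Recoloring G ℓ in
    ∀ {S L} → Unique S → Unique L → ∀ {v} → v ∈ S → Target S L → Reduction S L
  reduce {ℓ} {S} uS uL v∈ t with Structure.dominated⊎incomparable G ℓ S
  ... | inj₁ dom = dom
  ... | inj₂ inc = by-cases H∈ freeᴴ
    where
    open Recoloring G ℓ using (Reduction)
    open Patterns G
    open Structure.Reduce G ℓ (no2K₂ free₂) uS uL v∈ t inc
    by-cases : ∀ {H} → H ∈ triangle ∷ paw ∷ claw ∷ diamond ∷ [] → ¬ InducedCopy H G → Reduction S _
    by-cases (here refl) free = PawFree.reduction (noPaw-triangle free)
    by-cases (there (here refl)) free = PawFree.reduction (noPaw free)
    by-cases (there (there (here refl))) free = ClawFree.reduction (noClaw free)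
    by-cases (there (there (there (here refl)))) free = DiamondFree.reduction (noDiamond free)
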